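{- Let $P$ be the transition matrix of a reversible and ergodic Markov chain on $V$ with stationary distribution $\pi$ and mixing rate $t^*$. For the quasi-random router model for $P$ with any initial configuration of $M$ tokens, $$\left|\chi^{(T)}_w-\mu^{(T)}_w\right|\le\frac{6\pi_w}{\pi_{\min}}\,\lg(M+1)\,t^*\,\Delta$$ for all $w\in V$ and $T\ge0$.
   Context: Let $V=\{1,\dots,N\}$ and let $P\in\mathbb{R}_{\ge 0}^{N\times N}$ be an ergodic (irreducible, aperiodic) stochastic matrix with stationary distribution $\pi$; $\pi_{\min}=\min_v\pi_v$; reversible means $\pi_uP_{u,v}=\pi_vP_{v,u}$ for all $u,v$. For $v\in V$ let $\mathcal N(v)=\{u: P_{v,u}>0\}$, $\delta(v)=|\mathcal N(v)|$, $\Delta=\max_v\delta(v)$; $\lg=\log_2$. Total variation distance $d_{TV}(\xi,\zeta)=\frac12\|\xi-\zeta\|_1$; mixing time $\tau(\varepsilon)=\max_{v}\min\{t\ge0: d_{TV}(P^t_{v,\cdot},\pi)\le\varepsilon\}$; mixing rate $t^*=\tau(1/4)$. The van der Corput function $\psi$: $\psi(0)=0$ and for $i=\sum_j\beta_j(i)2^j>0$ in binary, $\psi(i)=\sum_j\beta_j(i)2^{ -(j+1)}$. The quasi-random router: fix an ordering $u_1,\dots,u_{\delta(v)}$ of $\mathcal N(v)$ and set $\sigma_v(i)=u_k$ where $\sum_{j=1}^{k-1}P_{v,u_j}\le\psi(i)<\sum_{j=1}^{k}P_{v,u_j}$. Write $I_{v,u}[z,z')=|\{j\in\{z,\dots,z'-1\}:\sigma_v(j)=u\}|$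 (zero if $z'\le z$). Given $\chi^{(0)}\in\mathbb{Z}_{\ge0}^N$ with $\sum_v\chi^{(0)}_v=M$, set $Z^{(t)}_{v,u}=I_{v,u}\big[\sum_{s=0}^{t-1}\chi^{(s)}_v,\sum_{s=0}^{t}\chi^{(s)}_v\big)$, $\chi^{(t+1)}_u=\sum_vZ^{(t)}_{v,u}$, $\mu^{(0)}=\chi^{(0)}$, $\mu^{(t)}=\mu^{(0)}P^t$. -}

module Defs where

open import Level using (0ℓ)
open import Algebra.Bundles using (CommutativeRing)
open import Data.Bool.Base using (if_then_else_)
open import Data.Fin.Base using (Fin; zero; toℕ)
import Data.Fin.Properties as Fin
open import Data.List.Base as List using (List; length; filter; lookup; allFin; applyUpTo)
import Data.List.Extrema
import Data.List.Extrema.Nat as ℕExtrema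
open import Data.List.Relation.Binary.Permutation.Propositional using (_↭_)
open import Data.Nat.Base as ℕ using (ℕ; zero; suc; NonZero; z≤n; s≤s)
open import Data.Nat.Divisibility using (_∣_)
open import Data.Nat.DivMod using (_/_; _%_)
import Data.Nat.Properties as ℕ
open import Data.Product.Base using (∃; ∃-syntax; Σ-syntax; _×_; _,_; proj₁)
open import Data.Sum.Base using (inj₁; inj₂)
open import Data.Vec.Functional using (Vector)
open import Relation.Binary.Bundles using (TotalOrder)
open import Relation.Binary.Core using (Rel)
import Relation.Binary.Construct.NonStrictToStrict as NonStrictToStrict
open import Relation.Binary.Definitions using (Decidable)
open import Relation.Binary.PropositionalEquality using (_≡_; subst)
import Relation.Binary.PropositionalEquality as ≡
open import Relation.Binary.Structures using (IsDecTotalOrder)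
open import Relation.Nullary using (¬_; does; contradiction)
import Algebra.Properties.CommutativeMonoid.Sum as Sum
import Algebra.Properties.Ring as RingProperties
import Algebra.Properties.Semiring.Exp as Exp
import Algebra.Properties.Semiring.Mult as Mult

open Sum ℕ.+-0-commutativeMonoid public using () renaming (sum to ∑ℕ)

-- The real numbers, axiomatised classically: a complete ordered field is
-- unique up to isomorphism.  `_⁻¹` is total; its value at 0# is unconstrained.
record CompleteOrderedField : Set₁ where
  infix 8 _⁻¹
  infix 4 _≤_
  field
    commutativeRing : CommutativeRing 0ℓ 0ℓ

  open CommutativeRing commutativeRing public

  field
    0≉1             : ¬ 0# ≈ 1#
    _⁻¹             : Carrier → Carrier
    ⁻¹-cong         : ∀ {x y} → x ≈ y → x ⁻¹ ≈ y ⁻¹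
    *-inverseʳ      : ∀ x → ¬ x ≈ 0# → x * x ⁻¹ ≈ 1#
    _≤_             : Rel Carrier 0ℓ
    isDecTotalOrder : IsDecTotalOrder _≈_ _≤_
    +-monoʳ-≤       : ∀ x {y z} → y ≤ z → x + y ≤ x + z
    *-nonNegative   : ∀ {x y} → 0# ≤ x → 0# ≤ y → 0# ≤ x * y

  IsUpperBound : (Carrier → Set) → Carrier → Set
  IsUpperBound S b = ∀ x → S x → x ≤ b

  IsSupremum : (Carrier → Set) → Carrier → Set
  IsSupremum S s = IsUpperBound S s × (∀ b → IsUpperBound S b → s ≤ b)

  field
    complete : ∀ (S : Carrier → Set) → ∃ S → ∃ (IsUpperBound S) → ∃ (IsSupremum S)

module Real {{ℝ : CompleteOrderedField}} where

  open CompleteOrderedField ℝ public hiding (zero)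
  open IsDecTotalOrder isDecTotalOrder public using (_≤?_; isTotalOrder; total)
    renaming (_≟_ to _≈?_; antisym to ≤-antisym;
              trans to ≤-trans; refl to ≤-refl;
              ≤-respˡ-≈ to ≤-respˡ; ≤-respʳ-≈ to ≤-respʳ)

  open NonStrictToStrict _≈_ _≤_ public using (_<_)

  totalOrder : TotalOrder 0ℓ 0ℓ 0ℓ
  totalOrder = record { isTotalOrder = isTotalOrder }

  _<?_ : Decidable _<_
  _<?_ = NonStrictToStrict.<-decidable _≈_ _≤_ _≈?_ _≤?_

  open Sum +-commutativeMonoid public using (sum)
  open Exp semiring public using (_^_)
  open Mult semiring public using () renaming (_×_ to _·_)

  infix 4 _<?_
  infixl 7 _÷_

  _÷_ : Carrier → Carrier → Carrier
  x ÷ y = x * y ⁻¹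

  fromℕ : ℕ → Carrier
  fromℕ n = n · 1#

  ½ : Carrier
  ½ = 1# ÷ fromℕ 2

  ¼ : Carrier
  ¼ = 1# ÷ fromℕ 4

  ∣_∣ : Carrier → Carrier
  ∣ x ∣ = if does (0# ≤? x) then x else - x

  private
    module RP = RingProperties ring
    module MP = Mult semiring

    0≤1 : 0# ≤ 1#
    0≤1 with total 0# 1#
    ... | inj₁ p = p
    ... | inj₂ p = ≤-respʳ (trans (sym (RP.-‿distribˡ-* 1# (- 1#)))
                     (trans (-‿cong (*-identityˡ (- 1#))) (RP.-‿involutive 1#)))
                     (*-nonNegative 0≤-1 0≤-1)
      where
      0≤-1 : 0# ≤ - 1#
      0≤-1 = ≤-respˡ (-‿inverseˡ 1#) (≤-respʳ (+-identityʳ (- 1#)) (+-monoʳ-≤ (- 1#) p))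

    fromℕ-nonneg : ∀ n → 0# ≤ fromℕ n
    fromℕ-nonneg zero    = ≤-refl
    fromℕ-nonneg (suc n) = ≤-trans 0≤1 (≤-respˡ (+-identityʳ 1#) (+-monoʳ-≤ 1# (fromℕ-nonneg n)))

    fromℕ-mono : ∀ {m n} → m ℕ.≤ n → fromℕ m ≤ fromℕ n
    fromℕ-mono {n = n} z≤n = fromℕ-nonneg n
    fromℕ-mono (s≤s p) = +-monoʳ-≤ 1# (fromℕ-mono p)

    fromℕ-suc≉0 : ∀ n → ¬ fromℕ (suc n) ≈ 0#
    fromℕ-suc≉0 n eq = 0≉1 (≤-antisym 0≤1 (≤-respʳ eq
      (≤-respˡ (+-identityʳ 1#) (+-monoʳ-≤ 1# (fromℕ-nonneg n)))))

    x≤y⇒0≤y-x : ∀ {x y} → x ≤ y → 0# ≤ y - x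
    x≤y⇒0≤y-x {x} {y} p = ≤-respˡ (-‿inverseˡ x) (≤-respʳ (+-comm (- x) y) (+-monoʳ-≤ (- x) p))

    *-monoʳ : ∀ {x y z} → 0# ≤ z → x ≤ y → x * z ≤ y * z
    *-monoʳ {x} {y} {z} 0≤z x≤y =
      ≤-respˡ (+-identityʳ (x * z)) (≤-respʳ eq (+-monoʳ-≤ (x * z) (*-nonNegative (x≤y⇒0≤y-x x≤y) 0≤z)))
      where
      eq : x * z + (y - x) * z ≈ y * z
      eq = trans (sym (distribʳ z x (y - x)))
             (*-congʳ (trans (+-comm x (y - x)) (trans (+-assoc y (- x) x)
               (trans (+-congˡ (-‿inverseˡ x)) (+-identityʳ y)))))

    ⁻¹-nonneg : ∀ n → 0# ≤ fromℕ (suc n) ⁻¹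
    ⁻¹-nonneg n with total 0# (fromℕ (suc n) ⁻¹)
    ... | inj₁ p = p
    ... | inj₂ p = contradiction (≤-antisym 0≤1 1≤0) 0≉1
      where
      1≤0 : 1# ≤ 0#
      1≤0 = ≤-respˡ (trans (*-comm _ _) (*-inverseʳ _ (fromℕ-suc≉0 n)))
              (≤-respʳ (zeroˡ _) (*-monoʳ (fromℕ-nonneg (suc n)) p))

    n<2^n : ∀ n → n ℕ.< 2 ℕ.^ n
    n<2^n zero    = s≤s z≤n
    n<2^n (suc n) = ℕ.≤-trans (ℕ.+-mono-≤ (ℕ.m^n>0 2 n) (n<2^n n))
                      (ℕ.+-monoʳ-≤ (2 ℕ.^ n) (ℕ.m≤m+n (2 ℕ.^ n) 0))

    exponent-bound : ∀ n p q → 2 ℕ.^ p ℕ.≤ n ℕ.^ q → p ℕ.≤ n ℕ.* q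
    exponent-bound n p q h = ℕ.≮⇒≥ λ nq<p → ℕ.<-irrefl ≡.refl
      (ℕ.<-≤-trans (ℕ.^-monoʳ-< 2 (s≤s (s≤s z≤n)) nq<p)
        (ℕ.≤-trans h (subst (n ℕ.^ q ℕ.≤_) (ℕ.^-*-assoc 2 n q) (ℕ.^-monoˡ-≤ q (ℕ.<⇒≤ (n<2^n n))))))

  -- The rationals p/q ≥ 0 with 2^(p/q) ≤ n, i.e. 2^p ≤ n^q.
  Lg-Cut : ℕ → Carrier → Set
  Lg-Cut n x = ∃[ p ] ∃[ q ] NonZero q × 2 ℕ.^ p ℕ.≤ n ℕ.^ q × x ≈ fromℕ p ÷ fromℕ q

  private
    cut-inhabited : ∀ n → .{{NonZero n}} → ∃ (Lg-Cut n)
    cut-inhabited n = fromℕ 0 ÷ fromℕ 1 , 0 , 1 , _ , ℕ.m^n>0 n 1 , refl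

    cut-bounded : ∀ n → IsUpperBound (Lg-Cut n) (fromℕ n)
    cut-bounded n x (p , suc q , _ , h , eq) = ≤-respˡ (sym eq)
      (≤-respʳ cancel (*-monoʳ (⁻¹-nonneg q) (fromℕ-mono (exponent-bound n p (suc q) h))))
      where
      cancel : fromℕ (n ℕ.* suc q) ÷ fromℕ (suc q) ≈ fromℕ n
      cancel = trans (*-congʳ (MP.×1-homo-* n (suc q)))
        (trans (*-assoc _ _ _) (trans (*-congˡ (*-inverseʳ _ (fromℕ-suc≉0 q))) (*-identityʳ _)))

  -- log₂ n = sup { r ∈ ℚ≥0 : 2^r ≤ n }  for n ≥ 1.
  lg : (n : ℕ) → .{{NonZero n}} → Carrier
  lg n = proj₁ (complete (Lg-Cut n) (cut-inhabited n) (fromℕ n , cut-bounded n))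

  minimum : ∀ {n} → Vector Carrier (suc n) → Carrier
  minimum f = Data.List.Extrema.min totalOrder (f zero) (List.tabulate f)

maximumℕ : ∀ {n} → Vector ℕ n → ℕ
maximumℕ f = ℕExtrema.max 0 (List.tabulate f)

IsLeast : (ℕ → Set) → ℕ → Set
IsLeast S t = S t × (∀ s → S s → t ℕ.≤ s)

module MarkovChain {{ℝ : CompleteOrderedField}} where

  open Real {{ℝ}}

  Matrix : ℕ → Set
  Matrix N = Fin N → Fin N → Carrier

  matrixPower : ∀ {N} → Matrix N → ℕ → Matrix N
  matrixPower P zero    u v = if does (u Fin.≟ v) then 1# else 0#
  matrixPower P (suc t) u v = sum λ w → matrixPower P t u w * P w v

  IsDistribution : ∀ {N} → Vector Carrier N → Set
  IsDistribution ξ = (∀ v → 0# ≤ ξ v) × sum ξ ≈ 1#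

  IsStochastic : ∀ {N} → Matrix N → Set
  IsStochastic P = ∀ u → IsDistribution (P u)

  IsIrreducible : ∀ {N} → Matrix N → Set
  IsIrreducible P = ∀ u v → ∃[ t ] 0# < matrixPower P t u v

  -- gcd { t > 0 : P^t(v,v) > 0 } = 1 for every v: no common divisor except 1.
  IsAperiodic : ∀ {N} → Matrix N → Set
  IsAperiodic P = ∀ v d →
    (∀ t → 0 ℕ.< t → 0# < matrixPower P t v v → d ∣ t) → d ≡ 1

  record IsErgodic {N} (P : Matrix N) : Set where
    field
      stochastic  : IsStochastic P
      irreducible : IsIrreducible P
      aperiodic   : IsAperiodic P

  IsStationary : ∀ {N} → Matrix N → Vector Carrier N → Set
  IsStationary P π = IsDistribution π × (∀ v → sum (λ u → π u * P u v) ≈ π v)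

  IsReversible : ∀ {N} → Matrix N → Vector Carrier N → Set
  IsReversible P π = ∀ u v → π u * P u v ≈ π v * P v u

  dTV : ∀ {N} → Vector Carrier N → Vector Carrier N → Carrier
  dTV ξ ζ = ½ * sum (λ v → ∣ ξ v - ζ v ∣)

  -- τ(ε) = max over v of min { t ≥ 0 : dTV (P^t(v,·)) π ≤ ε }.  The minima are
  -- given relationally, since their existence is the convergence theorem.
  IsMixingTime : ∀ {N} → Matrix N → Vector Carrier N → Carrier → ℕ → Set
  IsMixingTime {N} P π ε τ = Σ[ τᵥ ∈ Vector ℕ N ]
    (∀ v → IsLeast (λ t → dTV (matrixPower P t v) π ≤ ε) (τᵥ v)) × τ ≡ maximumℕ τᵥ

  IsMixingRate : ∀ {N} → Matrix N → Vector Carrier N → ℕ → Set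
  IsMixingRate P π t* = IsMixingTime P π ¼ t*

  neighbours : ∀ {N} → Matrix N → Fin N → List (Fin N)
  neighbours {N} P v = filter (λ u → 0# <? P v u) (allFin N)

  degree : ∀ {N} → Matrix N → Fin N → ℕ
  degree P v = length (neighbours P v)

  maxDegree : ∀ {N} → Matrix N → ℕ
  maxDegree P = maximumℕ (degree P)

  binaryDigit : ℕ → ℕ → ℕ
  binaryDigit j i = (i / 2 ℕ.^ j) {{ℕ.m^n≢0 2 j}} % 2

  -- The digits βⱼ(i) with j ≥ i vanish, as i < 2^i.
  ψ : ℕ → Carrier
  ψ i = sum {i} λ j → fromℕ (binaryDigit (toℕ j) i) * ½ ^ suc (toℕ j)

  record QuasiRandomRouter {N} (P : Matrix N) : Set where
    field
      order   : Fin N → List (Fin N)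
      order-↭ : ∀ v → order v ↭ neighbours P v

    -- P(v,u₁) + … + P(v,uₖ)
    partialSum : Fin N → ℕ → Carrier
    partialSum v k = List.foldr _+_ 0# (List.map (P v) (List.take k (order v)))

    field
      σ      : Fin N → ℕ → Fin N
      -- The 0-based index k stands for u₍ₖ₊₁₎.
      σ-spec : ∀ v i → Σ[ k ∈ Fin (length (order v)) ]
                 partialSum v (toℕ k) ≤ ψ i × ψ i < partialSum v (suc (toℕ k)) ×
                 σ v i ≡ lookup (order v) k

    -- Number of j with z ≤ j < z′ and σ v j ≡ u.
    I : Fin N → Fin N → ℕ → ℕ → ℕ
    I v u z z′ = length (filter (λ j → σ v j Fin.≟ u) (applyUpTo (z ℕ.+_) (z′ ℕ.∸ z)))

    -- χ χ₀ t is the configuration at time t, and served χ₀ t v = Σ_{s<t} χ χ₀ s v.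
    χ      : Vector ℕ N → ℕ → Vector ℕ N
    served : Vector ℕ N → ℕ → Vector ℕ N
    Z      : Vector ℕ N → ℕ → Fin N → Fin N → ℕ

    χ χ₀ zero    u = χ₀ u
    χ χ₀ (suc t) u = ∑ℕ λ v → Z χ₀ t v u

    served χ₀ zero    v = 0
    served χ₀ (suc t) v = served χ₀ t v ℕ.+ χ χ₀ t v

    Z χ₀ t v u = I v u (served χ₀ t v) (served χ₀ t v ℕ.+ χ χ₀ t v)

  open QuasiRandomRouter public

  μ : ∀ {N} → Matrix N → Vector ℕ N → ℕ → Vector Carrier N
  μ P χ₀ t w = sum λ v → fromℕ (χ₀ v) * matrixPower P t v w

open Real public
open MarkovChain public

{-# OPTIONS --safe #-}

-- Telescoping over time writes χ^(T)_w - μ^(T)_w as a sum over s < T of the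
-- routing error of one step, pushed through P^s.  A routing error has total
-- mass 0, so P^s_{u,w} may be replaced by P^s_{u,w} - π_w, which by reversibility
-- is (π_w / π_u) (P^s_{w,u} - π_u).
--
-- The share of the routing error due to one edge (v,u) is the discrepancy of
-- n ≤ M consecutive van der Corput points on a half-open interval, i.e. a
-- difference of two discrepancies on intervals [0,x).  Since ψ(2i) = ½ ψ(i) and
-- ψ(2i+1) = ½ + ½ ψ(i), a run of 2m consecutive integers splits by parity into
-- two halved copies of runs of length m, in [0,½) and in [½,1), and x cuts only
-- one of them: any bound for n = m is one for n = 2m, and an extra point costs at
-- most 1.  Hence the number of ones in the binary expansion of n is a bound, and
-- it is at most lg (M+1).
--
-- With D(s) = ‖P^s_{w,·} - π‖₁ one has D(s) ≤ 2, D(s) ≤ ½ for s ≥ t*, and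
-- D(t* + s) ≤ ½ D(s); therefore Σ_s D(s) ≤ 2 t* + t*.
module Submission where

import Algebra.Properties.CommutativeMonoid.Sum as Sum
import Algebra.Properties.Ring as RingProperties
import Algebra.Properties.Semiring.Mult as Mult
import Algebra.Properties.Semiring.Sum as SemiringSum
import Algebra.Solver.Ring.NaturalCoefficients.Default as Solver
open import Data.Bool.Base using (if_then_else_)
open import Data.Fin.Base using (Fin; zero; suc; toℕ)
import Data.Fin.Properties as Fin
open import Data.List.Base as List using (List; []; _∷_; length; filter; lookup; tabulate; applyUpTo)
import Data.List.Extrema
import Data.List.Extrema.Nat as ℕExtrema
open import Data.List.Membership.Propositional using (_∈_)
open import Data.List.Membership.Propositional.Properties using (∈-lookup; ∈-filter⁺; ∈-filter⁻; ∈-allFin)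
open import Data.List.Relation.Binary.Permutation.Propositional using (_↭_; ↭-sym; ↭⇒↭ₛ; ↭⇒↭ₛ′)
open import Data.List.Relation.Binary.Permutation.Propositional.Properties using (∈-resp-↭; map⁺)
import Data.List.Relation.Binary.Permutation.Setoid.Properties as SetoidPermutation
import Data.List.Relation.Unary.All as All
import Data.List.Relation.Unary.All.Properties as All
open import Data.List.Relation.Unary.AllPairs using (_∷_)
import Data.List.Relation.Unary.Any as Any
import Data.List.Relation.Unary.Any.Properties as Any
open import Data.List.Relation.Unary.Unique.Propositional using (Unique)
open import Data.List.Relation.Unary.Unique.Propositional.Properties using (allFin⁺; filter⁺)
open import Data.Nat.Base as ℕ using (ℕ; zero; suc; z≤n; s≤s)
open import Data.Nat.Divisibility using (n∣m*n)
open import Data.Nat.DivMod using (_/_; _%_; n/1≡n; m/n/o≡m/[n*o]; m/n<m; m%n<n; m*n/n≡m; m*n%n≡0; [m+kn]%n≡m%n; +-distrib-/-∣ʳ)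
open import Data.Nat.Induction using (<-rec)
import Data.Nat.Properties as ℕ
open import Data.Product.Base using (∃-syntax; _×_; _,_; proj₁; proj₂)
open import Data.Sum.Base using (_⊎_; inj₁; inj₂)
open import Data.Vec.Functional using (Vector)
open import Function.Base using (_∘_)
open import Level using (0ℓ)
open import Relation.Binary.Bundles using (TotalOrder)
import Relation.Binary.Construct.NonStrictToStrict as NonStrictToStrict
open import Relation.Binary.Definitions using (tri<; tri≈; tri>)
open import Relation.Binary.PropositionalEquality using (_≡_)
import Relation.Binary.PropositionalEquality as ≡
import Relation.Binary.Reasoning.PartialOrder as PartialOrderReasoning
open import Relation.Nullary using (¬_; Dec; yes; no; does; contradiction)
open import Relation.Unary using (Pred; Decidable)
open import Defs using (CompleteOrderedField; module Real; module MarkovChain; ∑ℕ; maximumℕ)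

module _ {{ℝ : CompleteOrderedField}} where

  open Real {{ℝ}}
  open MarkovChain {{ℝ}}
  open Mult semiring using (×-homo-+; ×1-homo-*)
  open PartialOrderReasoning (TotalOrder.poset totalOrder)
  open RingProperties ring
    using (-‿involutive; -‿distribˡ-*; -‿distribʳ-*; -‿+-comm; -0#≈0#)
  open SemiringSum semiring using (*-distribˡ-sum; *-distribʳ-sum)
  open Solver commutativeSemiring using (solve; _:=_; _:+_; _:*_; con)
  open Sum +-commutativeMonoid
    using (sum-cong-≋; ∑-distrib-+; ∑-comm; sum-replicate-zero)

  private
    module Extrema = Data.List.Extrema totalOrder
    module < = NonStrictToStrict _≈_ _≤_

  -- Ordered fields

  ≤-reflexive : ∀ {x y} → x ≈ y → x ≤ y
  ≤-reflexive x≈y = ≤-respʳ x≈y ≤-refl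

  ≰⇒> : ∀ {x y} → ¬ x ≤ y → y < x
  ≰⇒> = <.≰⇒> sym ≤-reflexive total

  ≮⇒≥ : ∀ {x y} → ¬ x < y → y ≤ x
  ≮⇒≥ = <.≮⇒≥ sym _≈?_ ≤-reflexive total

  <⇒≱ : ∀ {x y} → x < y → ¬ y ≤ x
  <⇒≱ = <.<⇒≱ ≤-antisym

  +-mono-≤ : ∀ {a b c d} → a ≤ b → c ≤ d → a + c ≤ b + d
  +-mono-≤ {a} {b} {c} {d} a≤b c≤d = begin
    a + c ≤⟨ +-monoʳ-≤ a c≤d ⟩
    a + d ≈⟨ +-comm a d ⟩
    d + a ≤⟨ +-monoʳ-≤ d a≤b ⟩
    d + b ≈⟨ +-comm d b ⟩
    b + d ∎

  +-nonNegative : ∀ {x y} → 0# ≤ x → 0# ≤ y → 0# ≤ x + y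
  +-nonNegative p q = ≤-respˡ (+-identityˡ 0#) (+-mono-≤ p q)

  x≤x+y : ∀ {x y} → 0# ≤ y → x ≤ x + y
  x≤x+y {x} p = ≤-respˡ (+-identityʳ x) (+-monoʳ-≤ x p)

  x≤y+x : ∀ {x y} → 0# ≤ y → x ≤ y + x
  x≤y+x {x} {y} p = ≤-respʳ (+-comm x y) (x≤x+y p)

  x+y-y≈x : ∀ x y → (x + y) - y ≈ x
  x+y-y≈x x y = trans (+-assoc x y (- y)) (trans (+-congˡ (-‿inverseʳ y)) (+-identityʳ x))

  x-y+y≈x : ∀ x y → (x - y) + y ≈ x
  x-y+y≈x x y = trans (+-assoc x (- y) y) (trans (+-congˡ (-‿inverseˡ y)) (+-identityʳ x))

  +-cancelʳ-≤ : ∀ c {a b} → a + c ≤ b + c → a ≤ b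
  +-cancelʳ-≤ c {a} {b} p = begin
    a           ≈⟨ x+y-y≈x a c ⟨
    (a + c) - c ≤⟨ +-mono-≤ p ≤-refl ⟩
    (b + c) - c ≈⟨ x+y-y≈x b c ⟩
    b           ∎

  x≤y⇒0≤y-x : ∀ {x y} → x ≤ y → 0# ≤ y - x
  x≤y⇒0≤y-x {x} {y} p = +-cancelʳ-≤ x (begin
    0# + x    ≈⟨ +-identityˡ x ⟩
    x         ≤⟨ p ⟩
    y         ≈⟨ x-y+y≈x y x ⟨
    y - x + x ∎)

  neg-mono : ∀ {x y} → x ≤ y → - y ≤ - x
  neg-mono {x} {y} p = +-cancelʳ-≤ y (begin
    - y + y ≈⟨ trans (-‿inverseˡ y) (sym (-‿inverseˡ x)) ⟩
    - x + x ≤⟨ +-monoʳ-≤ (- x) p ⟩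
    - x + y ∎)

  *-monoˡ-≤ : ∀ {z} → 0# ≤ z → ∀ {x y} → x ≤ y → z * x ≤ z * y
  *-monoˡ-≤ {z} 0≤z {x} {y} p = begin
    z * x                 ≤⟨ x≤y+x (*-nonNegative 0≤z (x≤y⇒0≤y-x p)) ⟩
    z * (y - x) + z * x   ≈⟨ distribˡ z (y - x) x ⟨
    z * ((y - x) + x)     ≈⟨ *-congˡ (x-y+y≈x y x) ⟩
    z * y                 ∎

  *-monoʳ-≤ : ∀ {z} → 0# ≤ z → ∀ {x y} → x ≤ y → x * z ≤ y * z
  *-monoʳ-≤ {z} 0≤z {x} {y} p = begin
    x * z ≈⟨ *-comm x z ⟩
    z * x ≤⟨ *-monoˡ-≤ 0≤z p ⟩
    z * y ≈⟨ *-comm z y ⟩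
    y * z ∎

  -- Otherwise -1 is nonnegative, and 1 is its square.
  0≤1 : 0# ≤ 1#
  0≤1 with total 0# 1#
  ... | inj₁ p = p
  ... | inj₂ p = begin
    0#          ≤⟨ *-nonNegative q q ⟩
    - 1# * - 1# ≈⟨ -‿distribˡ-* 1# (- 1#) ⟨
    - (1# * - 1#) ≈⟨ -‿cong (*-identityˡ (- 1#)) ⟩
    - - 1#      ≈⟨ -‿involutive 1# ⟩
    1#          ∎
    where
    q : 0# ≤ - 1#
    q = ≤-respˡ -0#≈0# (neg-mono p)

  fromℕ-nonNegative : ∀ n → 0# ≤ fromℕ n
  fromℕ-nonNegative zero    = ≤-refl
  fromℕ-nonNegative (suc n) = +-nonNegative 0≤1 (fromℕ-nonNegative n)

  fromℕ-mono : ∀ {m n} → m ℕ.≤ n → fromℕ m ≤ fromℕ n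
  fromℕ-mono {n = n} z≤n = fromℕ-nonNegative n
  fromℕ-mono (s≤s p)     = +-monoʳ-≤ 1# (fromℕ-mono p)

  fromℕ-suc≉0 : ∀ n → ¬ fromℕ (suc n) ≈ 0#
  fromℕ-suc≉0 n eq = 0≉1 (≤-antisym 0≤1 (begin
    1#            ≤⟨ x≤x+y (fromℕ-nonNegative n) ⟩
    fromℕ (suc n) ≈⟨ eq ⟩
    0#            ∎))

  fromℕ-cancel-≤ : ∀ {m n} → fromℕ m ≤ fromℕ n → m ℕ.≤ n
  fromℕ-cancel-≤ {m} {n} p = ℕ.≮⇒≥ λ n<m → 0≉1 (≤-antisym 0≤1 (+-cancelʳ-≤ (fromℕ n) (begin
    1# + fromℕ n ≤⟨ fromℕ-mono n<m ⟩
    fromℕ m      ≤⟨ p ⟩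
    fromℕ n      ≈⟨ +-identityˡ _ ⟨
    0# + fromℕ n ∎)))

  ⁻¹-nonNegative : ∀ {x} → 0# < x → 0# ≤ x ⁻¹
  ⁻¹-nonNegative {x} (0≤x , 0≉x) with total 0# (x ⁻¹)
  ... | inj₁ p = p
  ... | inj₂ p = contradiction (≤-antisym 0≤1 (begin
    1#       ≈⟨ *-inverseʳ x (0≉x ∘ sym) ⟨
    x * x ⁻¹ ≤⟨ *-monoˡ-≤ 0≤x p ⟩
    x * 0#   ≈⟨ zeroʳ x ⟩
    0#       ∎)) 0≉1

  -- Shaped for the column estimate, where `a` is π_min and `y` is π_w.
  *≤⇒≤÷* : ∀ {a x y z} → 0# < a → a * x ≤ y * z → x ≤ (y ÷ a) * z
  *≤⇒≤÷* {a} {x} {y} {z} 0<a@(_ , 0≉a) p = begin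
    x               ≈⟨ *-identityˡ x ⟨
    1# * x          ≈⟨ *-congʳ (*-inverseʳ a (0≉a ∘ sym)) ⟨
    a * a ⁻¹ * x    ≈⟨ solve 3 (λ a b x → a :* b :* x := b :* (a :* x)) refl a (a ⁻¹) x ⟩
    a ⁻¹ * (a * x)  ≤⟨ *-monoˡ-≤ (⁻¹-nonNegative 0<a) p ⟩
    a ⁻¹ * (y * z)  ≈⟨ solve 3 (λ b y z → b :* (y :* z) := y :* b :* z) refl (a ⁻¹) y z ⟩
    (y ÷ a) * z     ∎

  *-positive : ∀ {x y} → 0# < x → 0# < y → 0# < x * y
  *-positive {x} {y} (0≤x , 0≉x) (0≤y , 0≉y) =
    *-nonNegative 0≤x 0≤y , λ eq → 0≉y (begin-equality
      0#              ≈⟨ zeroʳ (x ⁻¹) ⟨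
      x ⁻¹ * 0#       ≈⟨ *-congˡ eq ⟩
      x ⁻¹ * (x * y)  ≈⟨ solve 3 (λ b x y → b :* (x :* y) := x :* b :* y) refl (x ⁻¹) x y ⟩
      x * x ⁻¹ * y    ≈⟨ *-congʳ (*-inverseʳ x (0≉x ∘ sym)) ⟩
      1# * y          ≈⟨ *-identityˡ y ⟩
      y               ∎)

  ½+½≈1 : ½ + ½ ≈ 1#
  ½+½≈1 = begin-equality
    ½ + ½                      ≈⟨ solve 2 (λ i h → i :* h :+ i :* h := (i :+ (i :+ con 0)) :* h) refl 1# (fromℕ 2 ⁻¹) ⟩
    fromℕ 2 * fromℕ 2 ⁻¹       ≈⟨ *-inverseʳ (fromℕ 2) (fromℕ-suc≉0 1) ⟩
    1#                         ∎

  ½*x+½*x≈x : ∀ x → ½ * x + ½ * x ≈ x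
  ½*x+½*x≈x x = trans (sym (distribʳ x ½ ½)) (trans (*-congʳ ½+½≈1) (*-identityˡ x))

  0≤½ : 0# ≤ ½
  0≤½ = *-nonNegative 0≤1 (⁻¹-nonNegative (fromℕ-nonNegative 2 , fromℕ-suc≉0 1 ∘ sym))

  ¼+¼≈½ : ¼ + ¼ ≈ ½
  ¼+¼≈½ = begin-equality
    ¼ + ¼                        ≈⟨ *-identityˡ _ ⟨
    -- Inserting 2 · 2⁻¹ turns the doubled quarter into a multiple of 4 · 4⁻¹, which then cancels.
    1# * (¼ + ¼)                 ≈⟨ *-congʳ (*-inverseʳ (fromℕ 2) (fromℕ-suc≉0 1)) ⟨
    fromℕ 2 * h * (¼ + ¼)        ≈⟨ solve 3 (λ i h q → (i :+ (i :+ con 0)) :* h :* (i :* q :+ i :* q)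
                                       := i :* h :* ((i :+ (i :+ (i :+ (i :+ con 0)))) :* q)) refl 1# h q ⟩
    1# * h * (fromℕ 4 * q)       ≈⟨ *-congˡ (*-inverseʳ (fromℕ 4) (fromℕ-suc≉0 3)) ⟩
    1# * h * 1#                  ≈⟨ *-identityʳ ½ ⟩
    ½                            ∎
    where
    h = fromℕ 2 ⁻¹
    q = fromℕ 4 ⁻¹

  -- The value is given by a propositional equality so that `rewrite` removes the `if` inside `∣_∣`.
  ∣∣-cases : ∀ x → (0# ≤ x × ∣ x ∣ ≡ x) ⊎ (x ≤ 0# × ∣ x ∣ ≡ - x)
  ∣∣-cases x with 0# ≤? x
  ... | yes p = inj₁ (p , ≡.refl)
  ... | no ¬p = inj₂ (proj₁ (≰⇒> ¬p) , ≡.refl)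

  x≤∣x∣ : ∀ x → x ≤ ∣ x ∣
  x≤∣x∣ x with ∣∣-cases x
  ... | inj₁ (p , eq) rewrite eq = ≤-refl
  ... | inj₂ (p , eq) rewrite eq = begin
    x    ≤⟨ p ⟩
    0#   ≈⟨ -0#≈0# ⟨
    - 0# ≤⟨ neg-mono p ⟩
    - x  ∎

  -x≤∣x∣ : ∀ x → - x ≤ ∣ x ∣
  -x≤∣x∣ x with ∣∣-cases x
  ... | inj₂ (p , eq) rewrite eq = ≤-refl
  ... | inj₁ (p , eq) rewrite eq = begin
    - x  ≤⟨ neg-mono p ⟩
    - 0# ≈⟨ -0#≈0# ⟩
    0#   ≤⟨ p ⟩
    x    ∎

  ∣∣-least : ∀ {x c} → x ≤ c → - x ≤ c → ∣ x ∣ ≤ c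
  ∣∣-least {x} p q with ∣∣-cases x
  ... | inj₁ (_ , eq) rewrite eq = p
  ... | inj₂ (_ , eq) rewrite eq = q

  -- The two sides test different terms in their `if`; antisymmetry and `∣∣-least` avoid comparing
  -- the tests.
  ∣∣-cong : ∀ {x y} → x ≈ y → ∣ x ∣ ≈ ∣ y ∣
  ∣∣-cong {x} {y} x≈y = ≤-antisym (half x≈y) (half (sym x≈y))
    where
    half : ∀ {x y} → x ≈ y → ∣ x ∣ ≤ ∣ y ∣
    half eq = ∣∣-least (≤-respˡ (sym eq) (x≤∣x∣ _)) (≤-respˡ (-‿cong (sym eq)) (-x≤∣x∣ _))

  0≤∣x∣ : ∀ x → 0# ≤ ∣ x ∣
  0≤∣x∣ x with ∣∣-cases x
  ... | inj₁ (p , eq) rewrite eq = p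
  ... | inj₂ (p , eq) rewrite eq = ≤-respˡ -0#≈0# (neg-mono p)

  0≤x⇒∣x∣≈x : ∀ {x} → 0# ≤ x → ∣ x ∣ ≈ x
  0≤x⇒∣x∣≈x {x} p = ≤-antisym (∣∣-least ≤-refl (≤-trans (≤-respʳ -0#≈0# (neg-mono p)) p)) (x≤∣x∣ x)

  ∣-x∣≤∣x∣ : ∀ x → ∣ - x ∣ ≤ ∣ x ∣
  ∣-x∣≤∣x∣ x = ∣∣-least (-x≤∣x∣ x) (≤-respˡ (sym (-‿involutive x)) (x≤∣x∣ x))

  ∣x+y∣≤∣x∣+∣y∣ : ∀ x y → ∣ x + y ∣ ≤ ∣ x ∣ + ∣ y ∣
  ∣x+y∣≤∣x∣+∣y∣ x y = ∣∣-least (+-mono-≤ (x≤∣x∣ x) (x≤∣x∣ y))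
    (≤-respˡ (-‿+-comm x y) (+-mono-≤ (-x≤∣x∣ x) (-x≤∣x∣ y)))

  ∣x*y∣≤∣x∣*∣y∣ : ∀ x y → ∣ x * y ∣ ≤ ∣ x ∣ * ∣ y ∣
  ∣x*y∣≤∣x∣*∣y∣ x y with ∣∣-cases x
  ... | inj₁ (p , eq) rewrite eq = ∣∣-least (*-monoˡ-≤ p (x≤∣x∣ y))
    (≤-respˡ (sym (-‿distribʳ-* x y)) (*-monoˡ-≤ p (-x≤∣x∣ y)))
  ... | inj₂ (p , eq) rewrite eq = ∣∣-least
    (≤-respˡ (trans (sym (-‿distribˡ-* x (- y))) (trans (-‿cong (sym (-‿distribʳ-* x y))) (-‿involutive _)))
      (*-monoˡ-≤ q (-x≤∣x∣ y)))
    (≤-respˡ (sym (-‿distribˡ-* x y)) (*-monoˡ-≤ q (x≤∣x∣ y)))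
    where
    q : 0# ≤ - x
    q = ≤-respˡ -0#≈0# (neg-mono p)

  -- Encodes |x - y| ≤ c without subtraction, so that errors add up within the reach of the semiring
  -- solver.
  Near : Carrier → Carrier → Carrier → Set
  Near c x y = x ≤ y + c × y ≤ x + c

  near⇒∣-∣≤ : ∀ {c x y} → Near c x y → ∣ x - y ∣ ≤ c
  near⇒∣-∣≤ {c} {x} {y} (p , q) = ∣∣-least
    (+-cancelʳ-≤ y (begin
      x - y + y ≈⟨ x-y+y≈x x y ⟩
      x         ≤⟨ p ⟩
      y + c     ≈⟨ +-comm y c ⟩
      c + y     ∎))
    (+-cancelʳ-≤ x (begin
      - (x - y) + x ≈⟨ +-congʳ (sym (-‿+-comm x (- y))) ⟩
      - x + - - y + x ≈⟨ +-congʳ (trans (+-congˡ (-‿involutive y)) (+-comm (- x) y)) ⟩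
      y - x + x     ≈⟨ x-y+y≈x y x ⟩
      y             ≤⟨ q ⟩
      x + c         ≈⟨ +-comm x c ⟩
      c + x         ∎))

  x+x≤y+y⇒x≤y : ∀ {x y} → x + x ≤ y + y → x ≤ y
  x+x≤y+y⇒x≤y {x} {y} p = begin
    x              ≈⟨ ½*x+½*x≈x x ⟨
    ½ * x + ½ * x  ≈⟨ distribˡ ½ x x ⟨
    ½ * (x + x)    ≤⟨ *-monoˡ-≤ 0≤½ p ⟩
    ½ * (y + y)    ≈⟨ distribˡ ½ y y ⟩
    ½ * y + ½ * y  ≈⟨ ½*x+½*x≈x y ⟩
    y              ∎

  -- Finite sums

  sum-mono : ∀ {n} {f g : Vector Carrier n} → (∀ i → f i ≤ g i) → sum f ≤ sum g
  sum-mono {zero}  f≤g = ≤-refl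
  sum-mono {suc n} f≤g = +-mono-≤ (f≤g zero) (sum-mono (f≤g ∘ suc))

  sum-nonNegative : ∀ {n} {f : Vector Carrier n} → (∀ i → 0# ≤ f i) → 0# ≤ sum f
  sum-nonNegative {n} 0≤f = ≤-respˡ (sum-replicate-zero n) (sum-mono 0≤f)

  term≤sum : ∀ {n} {f : Vector Carrier n} → (∀ i → 0# ≤ f i) → ∀ i → f i ≤ sum f
  term≤sum 0≤f zero    = x≤x+y (sum-nonNegative (0≤f ∘ suc))
  term≤sum 0≤f (suc i) = ≤-trans (term≤sum (0≤f ∘ suc) i) (x≤y+x (0≤f zero))

  ∣sum∣≤sum∣∣ : ∀ {n} (f : Vector Carrier n) → ∣ sum f ∣ ≤ sum (λ i → ∣ f i ∣)
  ∣sum∣≤sum∣∣ {zero}  f = ≤-reflexive (0≤x⇒∣x∣≈x ≤-refl)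
  ∣sum∣≤sum∣∣ {suc n} f = ≤-trans (∣x+y∣≤∣x∣+∣y∣ _ _) (+-monoʳ-≤ _ (∣sum∣≤sum∣∣ (f ∘ suc)))

  sum-neg : ∀ {n} (f : Vector Carrier n) → sum (λ i → - f i) ≈ - sum f
  sum-neg {zero}  f = sym -0#≈0#
  sum-neg {suc n} f = trans (+-congˡ (sum-neg (f ∘ suc))) (-‿+-comm _ _)

  sum-sub : ∀ {n} (f g : Vector Carrier n) → sum (λ i → f i - g i) ≈ sum f - sum g
  sum-sub f g = trans (∑-distrib-+ f (λ i → - g i)) (+-congˡ (sum-neg g))

  fromℕ-∑ : ∀ {n} (f : Vector ℕ n) → fromℕ (∑ℕ f) ≈ sum (λ i → fromℕ (f i))
  fromℕ-∑ {zero}  f = refl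
  fromℕ-∑ {suc n} f = trans (×-homo-+ 1# (f zero) _) (+-congˡ (fromℕ-∑ (f ∘ suc)))

  sum-1 : ∀ n → sum {n} (λ _ → 1#) ≈ fromℕ n
  sum-1 zero    = refl
  sum-1 (suc n) = +-congˡ (sum-1 n)

  -- The entries of `matrixPower P 0` unfold to this form, so the facts on indicators apply to the
  -- identity matrix as well.
  𝟙 : ∀ {p} {P : Set p} → Dec P → Carrier
  𝟙 P? = if does P? then 1# else 0#

  𝟙-yes : ∀ {p} {P : Set p} (P? : Dec P) → P → 𝟙 P? ≈ 1#
  𝟙-yes (yes _) _ = refl
  𝟙-yes (no ¬p) p = contradiction p ¬p

  𝟙-no : ∀ {p} {P : Set p} (P? : Dec P) → ¬ P → 𝟙 P? ≈ 0#
  𝟙-no (yes p) ¬p = contradiction p ¬p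
  𝟙-no (no _)  _  = refl

  𝟙-cong : ∀ {p q} {P : Set p} {Q : Set q} (P? : Dec P) (Q? : Dec Q) →
           (P → Q) → (Q → P) → 𝟙 P? ≈ 𝟙 Q?
  𝟙-cong P? (yes q) _ g = 𝟙-yes P? (g q)
  𝟙-cong P? (no ¬q) f _ = 𝟙-no P? (¬q ∘ f)

  𝟙-nonNegative : ∀ {p} {P : Set p} (P? : Dec P) → 0# ≤ 𝟙 P?
  𝟙-nonNegative (yes _) = 0≤1
  𝟙-nonNegative (no _)  = ≤-refl

  𝟙≤1 : ∀ {p} {P : Set p} (P? : Dec P) → 𝟙 P? ≤ 1#
  𝟙≤1 (yes _) = ≤-refl
  𝟙≤1 (no _)  = 0≤1

  sum-zeroˡ : ∀ {n} (f : Vector Carrier n) → sum (λ i → 0# * f i) ≈ 0#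
  sum-zeroˡ {n} f = trans (sum-cong-≋ {n} (λ i → zeroˡ (f i))) (sum-replicate-zero n)

  sum-𝟙* : ∀ {n} (f : Vector Carrier n) i → sum (λ j → 𝟙 (i Fin.≟ j) * f j) ≈ f i
  -- The Boolean part of `Fin.≟` computes on constructors, so the indicators reduce and the
  -- recursive call fits as it stands.
  sum-𝟙* f zero    = trans (+-cong (*-identityˡ _) (sum-zeroˡ (f ∘ suc))) (+-identityʳ _)
  sum-𝟙* f (suc i) = trans (+-cong (zeroˡ _) (sum-𝟙* (f ∘ suc) i)) (+-identityˡ _)

  -- Sums over runs of consecutive integers

  sumFrom : (ℕ → Carrier) → ℕ → ℕ → Carrier
  sumFrom f z n = sum {n} λ i → f (z ℕ.+ toℕ i)

  sumFrom-cong : ∀ {f g : ℕ → Carrier} → (∀ j → f j ≈ g j) → ∀ z n → sumFrom f z n ≈ sumFrom g z n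
  sumFrom-cong f≈g z n = sum-cong-≋ {n} (λ i → f≈g (z ℕ.+ toℕ i))

  sumFrom-suc : ∀ (f : ℕ → Carrier) z n → sumFrom f z (suc n) ≈ f z + sumFrom f (suc z) n
  sumFrom-suc f z n = +-cong (reflexive (≡.cong f (ℕ.+-identityʳ z)))
    (sum-cong-≋ {n} (λ i → reflexive (≡.cong f (ℕ.+-suc z (toℕ i)))))

  -- The second run starts at `m ℕ.+ z`, with `m` first, so that the start computes in the recursion
  -- on `m`.
  sumFrom-+ : ∀ (f : ℕ → Carrier) z m n → sumFrom f z (m ℕ.+ n) ≈ sumFrom f z m + sumFrom f (m ℕ.+ z) n
  sumFrom-+ f z zero    n = sym (+-identityˡ _)
  sumFrom-+ f z (suc m) n = begin-equality
    sumFrom f z (suc (m ℕ.+ n))                                  ≈⟨ sumFrom-suc f z (m ℕ.+ n) ⟩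
    f z + sumFrom f (suc z) (m ℕ.+ n)                            ≈⟨ +-congˡ (sumFrom-+ f (suc z) m n) ⟩
    f z + (sumFrom f (suc z) m + sumFrom f (m ℕ.+ suc z) n)      ≈⟨ +-assoc _ _ _ ⟨
    f z + sumFrom f (suc z) m + sumFrom f (m ℕ.+ suc z) n
      ≈⟨ +-cong (sumFrom-suc f z m) (reflexive (≡.cong (λ k → sumFrom f k n) (≡.sym (ℕ.+-suc m z)))) ⟨
    sumFrom f z (suc m) + sumFrom f (suc m ℕ.+ z) n              ∎

  data Parity : ℕ → Set where
    even : ∀ k → Parity (k ℕ.* 2)
    odd  : ∀ k → Parity (suc (k ℕ.* 2))

  parity : ∀ n → Parity n
  parity zero = even 0
  parity (suc n) with parity n
  ... | even k = odd k
  ... | odd k  = even (suc k)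

  -- `g` stands for 2j or 2j + 1: one induction serves the runs that start at an even and at an odd
  -- integer.
  sumFrom-pairs : ∀ (f : ℕ → Carrier) (g : ℕ → ℕ) → (∀ j → g (suc j) ≡ suc (suc (g j))) → ∀ y m →
                  sumFrom f (g y) (m ℕ.* 2) ≈ sumFrom (λ j → f (g j) + f (suc (g j))) y m
  sumFrom-pairs f g g-suc y zero    = refl
  sumFrom-pairs f g g-suc y (suc m) = begin-equality
    sumFrom f (g y) (suc m ℕ.* 2)
      ≈⟨ sumFrom-suc f (g y) (suc (m ℕ.* 2)) ⟩
    f (g y) + sumFrom f (suc (g y)) (suc (m ℕ.* 2))
      ≈⟨ +-congˡ (sumFrom-suc f (suc (g y)) (m ℕ.* 2)) ⟩
    f (g y) + (f (suc (g y)) + sumFrom f (suc (suc (g y))) (m ℕ.* 2))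
      ≈⟨ +-assoc _ _ _ ⟨
    f (g y) + f (suc (g y)) + sumFrom f (suc (suc (g y))) (m ℕ.* 2)
      ≈⟨ +-congˡ (reflexive (≡.cong (λ k → sumFrom f k (m ℕ.* 2)) (≡.sym (g-suc y)))) ⟩
    f (g y) + f (suc (g y)) + sumFrom f (g (suc y)) (m ℕ.* 2)
      ≈⟨ +-congˡ (sumFrom-pairs f g g-suc (suc y) m) ⟩
    f (g y) + f (suc (g y)) + sumFrom h (suc y) m
      ≈⟨ sumFrom-suc h y m ⟨
    sumFrom h y (suc m) ∎
    where
    h : ℕ → Carrier
    h j = f (g j) + f (suc (g j))

  sumFrom-1+ : ∀ (f : ℕ → Carrier) z n → sumFrom (λ j → 1# + f j) z n ≈ fromℕ n + sumFrom f z n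
  sumFrom-1+ f z n = trans (∑-distrib-+ {n} (λ _ → 1#) (λ i → f (z ℕ.+ toℕ i))) (+-congʳ (sum-1 n))

  sum-const : ∀ n c → sum {n} (λ _ → c) ≈ fromℕ n * c
  sum-const n c = trans (sum-cong-≋ {n} (λ _ → sym (*-identityˡ c)))
    (trans (sym (*-distribʳ-sum {n} c (λ _ → 1#))) (*-congʳ (sum-1 n)))

  sumFrom-nonNegative : ∀ {f : ℕ → Carrier} → (∀ j → 0# ≤ f j) → ∀ z n → 0# ≤ sumFrom f z n
  sumFrom-nonNegative 0≤f z n = sum-nonNegative {n} (λ i → 0≤f (z ℕ.+ toℕ i))

  -- Beyond t the sum S of f satisfies S ≤ t ½ + ½ S, so no geometric series is needed.
  sumFrom-halving : ∀ (f : ℕ → Carrier) t → (∀ j → 0# ≤ f j) → (∀ j → f j ≤ fromℕ 2) →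
    (∀ j → f (t ℕ.+ j) ≤ ½) → (∀ j → f (t ℕ.+ j) ≤ ½ * f j) →
    ∀ n → sumFrom f 0 n ≤ fromℕ 3 * fromℕ t
  sumFrom-halving f t 0≤f f≤2 f≤½ halves n = begin
    -- Lengthening the run by `t` terms allows its first `t` terms to be split off whether or not
    -- `n` reaches `t`.
    sumFrom f 0 n                           ≤⟨ x≤x+y (sumFrom-nonNegative 0≤f (n ℕ.+ 0) t) ⟩
    sumFrom f 0 n + sumFrom f (n ℕ.+ 0) t   ≈⟨ sumFrom-+ f 0 n t ⟨
    sumFrom f 0 (n ℕ.+ t)                   ≈⟨ reflexive (≡.cong (sumFrom f 0) (ℕ.+-comm n t)) ⟩
    sumFrom f 0 (t ℕ.+ n)                   ≈⟨ sumFrom-+ f 0 t n ⟩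
    sumFrom f 0 t + sumFrom f (t ℕ.+ 0) n
      ≤⟨ +-mono-≤ (≤-respʳ (sum-const t (fromℕ 2)) (sum-mono {t} (λ i → f≤2 (toℕ i))))
                  (≤-respˡ (reflexive (≡.cong (λ z → sumFrom f z n) (≡.sym (ℕ.+-identityʳ t)))) A≤t) ⟩
    fromℕ t * fromℕ 2 + fromℕ t             ≈⟨ +-congˡ (*-identityʳ (fromℕ t)) ⟨
    fromℕ t * fromℕ 2 + fromℕ t * 1#
      ≈⟨ solve 2 (λ i t → t :* (i :+ (i :+ con 0)) :+ t :* i := (i :+ (i :+ (i :+ con 0))) :* t) refl 1# (fromℕ t) ⟩
    fromℕ 3 * fromℕ t                       ∎
    where
    A = sumFrom f t n
    step : A ≤ fromℕ t * ½ + ½ * A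
    step = begin
      A                                         ≤⟨ x≤x+y (sumFrom-nonNegative 0≤f (n ℕ.+ t) t) ⟩
      A + sumFrom f (n ℕ.+ t) t                 ≈⟨ sumFrom-+ f t n t ⟨
      sumFrom f t (n ℕ.+ t)                     ≈⟨ reflexive (≡.cong (sumFrom f t) (ℕ.+-comm n t)) ⟩
      sumFrom f t (t ℕ.+ n)                     ≈⟨ sumFrom-+ f t t n ⟩
      sumFrom f t t + sumFrom f (t ℕ.+ t) n
        ≤⟨ +-mono-≤ (sum-mono {t} {g = λ _ → ½} (λ i → f≤½ (toℕ i)))
             (sum-mono {n} {g = λ i → ½ * f (t ℕ.+ toℕ i)} (λ i →
               ≤-respˡ (reflexive (≡.cong f (≡.sym (ℕ.+-assoc t t (toℕ i))))) (halves (t ℕ.+ toℕ i)))) ⟩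
      sum {t} (λ _ → ½) + sum {n} (λ i → ½ * f (t ℕ.+ toℕ i))
        ≈⟨ +-cong (sum-const t ½) (sym (*-distribˡ-sum {n} ½ (λ i → f (t ℕ.+ toℕ i)))) ⟩
      fromℕ t * ½ + ½ * A                       ∎
    ½A≤½t : ½ * A ≤ ½ * fromℕ t
    ½A≤½t = +-cancelʳ-≤ (½ * A) (begin
      ½ * A + ½ * A         ≈⟨ ½*x+½*x≈x A ⟩
      A                     ≤⟨ step ⟩
      fromℕ t * ½ + ½ * A   ≈⟨ +-congʳ (*-comm _ _) ⟩
      ½ * fromℕ t + ½ * A   ∎)
    A≤t : A ≤ fromℕ t
    A≤t = begin
      A                         ≈⟨ ½*x+½*x≈x A ⟨
      ½ * A + ½ * A             ≤⟨ +-mono-≤ ½A≤½t ½A≤½t ⟩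
      ½ * fromℕ t + ½ * fromℕ t ≈⟨ ½*x+½*x≈x (fromℕ t) ⟩
      fromℕ t                   ∎

  *∣∣≤∣*∣ : ∀ {a} → 0# ≤ a → ∀ x → a * ∣ x ∣ ≤ ∣ a * x ∣
  *∣∣≤∣*∣ {a} 0≤a x with ∣∣-cases x
  ... | inj₁ (_ , eq) rewrite eq = x≤∣x∣ (a * x)
  ... | inj₂ (_ , eq) rewrite eq = ≤-respˡ (-‿distribʳ-* a x) (-x≤∣x∣ (a * x))

  ∣x-y∣≤x+y : ∀ {x y} → 0# ≤ x → 0# ≤ y → ∣ x - y ∣ ≤ x + y
  ∣x-y∣≤x+y {x} {y} 0≤x 0≤y = ≤-trans (∣x+y∣≤∣x∣+∣y∣ x (- y))
    (+-mono-≤ (≤-reflexive (0≤x⇒∣x∣≈x 0≤x)) (≤-trans (∣-x∣≤∣x∣ y) (≤-reflexive (0≤x⇒∣x∣≈x 0≤y))))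

  *-distribʳ-sub : ∀ x y z → (x - y) * z ≈ x * z - y * z
  *-distribʳ-sub x y z = trans (distribʳ z x (- y)) (+-congˡ (sym (-‿distribˡ-* y z)))

  *-distribˡ-sub : ∀ x y z → x * (y - z) ≈ x * y - x * z
  *-distribˡ-sub x y z = trans (distribˡ x y (- z)) (+-congˡ (sym (-‿distribʳ-* x z)))

  sub-cong : ∀ {x x′ y y′} → x ≈ x′ → y ≈ y′ → x - y ≈ x′ - y′
  sub-cong p q = +-cong p (-‿cong q)

  -- The van der Corput sequence

  -- `ψ i` is the case `n = i`. Separating the number of terms from the argument permits a recursion
  -- that drops one digit while `i` is halved.
  digitSum : ℕ → ℕ → Carrier
  digitSum n i = sum {n} λ j → fromℕ (binaryDigit (toℕ j) i) * ½ ^ suc (toℕ j)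

  binaryDigit-suc : ∀ j i → binaryDigit (suc j) i ≡ binaryDigit j (i / 2)
  binaryDigit-suc j i = ≡.cong (_% 2) (≡.sym (m/n/o≡m/[n*o] i 2 (2 ℕ.^ j) {{_}} {{ℕ.m^n≢0 2 j}} {{ℕ.m^n≢0 2 (suc j)}}))

  digitSum-suc : ∀ n i → digitSum (suc n) i ≈ fromℕ (i % 2) * ½ + ½ * digitSum n (i / 2)
  digitSum-suc n i = +-cong
    (*-cong (reflexive (≡.cong (λ k → fromℕ (k % 2)) (n/1≡n i))) (*-identityʳ ½))
    (begin-equality
      sum {n} (λ j → fromℕ (binaryDigit (suc (toℕ j)) i) * ½ ^ suc (suc (toℕ j)))
        ≈⟨ sum-cong-≋ {n} shift ⟩
      sum {n} (λ j → ½ * (fromℕ (binaryDigit (toℕ j) (i / 2)) * ½ ^ suc (toℕ j)))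
        ≈⟨ *-distribˡ-sum ½ (λ (j : Fin n) → fromℕ (binaryDigit (toℕ j) (i / 2)) * ½ ^ suc (toℕ j)) ⟨
      ½ * digitSum n (i / 2) ∎)
    where
    shift : ∀ (j : Fin n) → fromℕ (binaryDigit (suc (toℕ j)) i) * ½ ^ suc (suc (toℕ j)) ≈
                            ½ * (fromℕ (binaryDigit (toℕ j) (i / 2)) * ½ ^ suc (toℕ j))
    shift j = trans (*-congʳ (reflexive (≡.cong fromℕ (binaryDigit-suc (toℕ j) i))))
      (solve 3 (λ d h p → d :* (h :* p) := h :* (d :* p)) refl _ ½ (½ ^ suc (toℕ j)))

  i≤1+n⇒i/2≤n : ∀ {n i} → i ℕ.≤ suc n → i / 2 ℕ.≤ n
  i≤1+n⇒i/2≤n {i = zero}  _ = z≤n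
  i≤1+n⇒i/2≤n {i = suc i} p = ℕ.≤-pred (ℕ.≤-trans (m/n<m (suc i) 2 (s≤s (s≤s z≤n))) p)

  digitSum-zero : ∀ n → digitSum n 0 ≈ 0#
  digitSum-zero zero    = refl
  digitSum-zero (suc n) = begin-equality
    digitSum (suc n) 0           ≈⟨ digitSum-suc n 0 ⟩
    0# * ½ + ½ * digitSum n 0    ≈⟨ +-cong (zeroˡ ½) (*-congˡ (digitSum-zero n)) ⟩
    0# + ½ * 0#                  ≈⟨ trans (+-identityˡ _) (zeroʳ ½) ⟩
    0#                           ∎

  -- No digit of `i` is cut off once there are at least `i` terms; halving `i` keeps this true while
  -- both lengths drop by one.
  digitSum-ext : ∀ m n i → i ℕ.≤ m → i ℕ.≤ n → digitSum m i ≈ digitSum n i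
  digitSum-ext zero    n    zero _ _ = sym (digitSum-zero n)
  digitSum-ext (suc m) zero zero _ _ = digitSum-zero (suc m)
  digitSum-ext (suc m) (suc n) i p q = begin-equality
    digitSum (suc m) i                              ≈⟨ digitSum-suc m i ⟩
    fromℕ (i % 2) * ½ + ½ * digitSum m (i / 2)      ≈⟨ +-congˡ (*-congˡ (digitSum-ext m n (i / 2) (i≤1+n⇒i/2≤n p) (i≤1+n⇒i/2≤n q))) ⟩
    fromℕ (i % 2) * ½ + ½ * digitSum n (i / 2)      ≈⟨ digitSum-suc n i ⟨
    digitSum (suc n) i                              ∎

  ψ-rec : ∀ i → ψ i ≈ fromℕ (i % 2) * ½ + ½ * ψ (i / 2)
  ψ-rec i = begin-equality
    -- One additional, vanishing term makes room for splitting off the lowest digit even if `i` is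
    -- 0; the `i` terms left over are then cut to `i / 2`.
    digitSum i i                                ≈⟨ digitSum-ext i (suc i) i ℕ.≤-refl (ℕ.n≤1+n i) ⟩
    digitSum (suc i) i                          ≈⟨ digitSum-suc i i ⟩
    fromℕ (i % 2) * ½ + ½ * digitSum i (i / 2)
      ≈⟨ +-congˡ (*-congˡ (digitSum-ext i (i / 2) (i / 2) (i≤1+n⇒i/2≤n (ℕ.n≤1+n i)) ℕ.≤-refl)) ⟩
    fromℕ (i % 2) * ½ + ½ * ψ (i / 2)           ∎

  ψ-even : ∀ j → ψ (j ℕ.* 2) ≈ ½ * ψ j
  ψ-even j = begin-equality
    ψ (j ℕ.* 2)                                             ≈⟨ ψ-rec (j ℕ.* 2) ⟩
    fromℕ (j ℕ.* 2 % 2) * ½ + ½ * ψ (j ℕ.* 2 / 2)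
      ≈⟨ +-cong (*-congʳ (reflexive (≡.cong fromℕ (m*n%n≡0 j 2)))) (*-congˡ (reflexive (≡.cong ψ (m*n/n≡m j 2)))) ⟩
    0# * ½ + ½ * ψ j                                        ≈⟨ trans (+-congʳ (zeroˡ ½)) (+-identityˡ _) ⟩
    ½ * ψ j                                                 ∎

  ψ-odd : ∀ j → ψ (suc (j ℕ.* 2)) ≈ ½ + ½ * ψ j
  ψ-odd j = begin-equality
    ψ (suc (j ℕ.* 2))                                       ≈⟨ ψ-rec (suc (j ℕ.* 2)) ⟩
    fromℕ (suc (j ℕ.* 2) % 2) * ½ + ½ * ψ (suc (j ℕ.* 2) / 2)
      ≈⟨ +-cong (*-congʳ (reflexive (≡.cong fromℕ ([m+kn]%n≡m%n 1 j 2))))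
                (*-congˡ (reflexive (≡.cong ψ (≡.trans (+-distrib-/-∣ʳ 1 {j ℕ.* 2} {2} (n∣m*n j)) (m*n/n≡m j 2))))) ⟩
    fromℕ 1 * ½ + ½ * ψ j                                   ≈⟨ +-congʳ (trans (*-congʳ (+-identityʳ 1#)) (*-identityˡ ½)) ⟩
    ½ + ½ * ψ j                                             ∎

  ψ-nonNegative : ∀ i → 0# ≤ ψ i
  ψ-nonNegative i = sum-nonNegative {i} λ j →
    *-nonNegative (fromℕ-nonNegative (binaryDigit (toℕ j) i)) (½^-nonNegative (suc (toℕ j)))
    where
    ½^-nonNegative : ∀ n → 0# ≤ ½ ^ n
    ½^-nonNegative zero    = 0≤1
    ½^-nonNegative (suc n) = *-nonNegative 0≤½ (½^-nonNegative n)

  -- Doubling the recursion gives 2ψ(i) = d + ψ(⌊i/2⌋) with d ≤ 1, so ψ(i) ≥ 1 would force ψ(⌊i/2⌋)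
  -- ≥ 1, against the induction hypothesis.
  ψ<1 : ∀ i → ψ i < 1#
  ψ<1 = <-rec _ step
    where
    step : ∀ i → (∀ {j} → j ℕ.< i → ψ j < 1#) → ψ i < 1#
    step zero      _   = 0≤1 , 0≉1
    step i@(suc k) rec = ≰⇒> λ 1≤ψ → <⇒≱ (rec (m/n<m i 2 (s≤s (s≤s z≤n))))
      (+-cancelʳ-≤ 1# (begin
        1# + 1#                 ≤⟨ +-mono-≤ 1≤ψ 1≤ψ ⟩
        ψ i + ψ i               ≈⟨ +-cong (ψ-rec i) (ψ-rec i) ⟩
        (d * ½ + ½ * x) + (d * ½ + ½ * x) ≈⟨ solve 3 (λ d h x → (d :* h :+ h :* x) :+ (d :* h :+ h :* x)
                                               := (h :* x :+ h :* x) :+ (h :* d :+ h :* d)) refl d ½ x ⟩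
        (½ * x + ½ * x) + (½ * d + ½ * d) ≈⟨ +-cong (½*x+½*x≈x x) (½*x+½*x≈x d) ⟩
        x + d                   ≤⟨ +-monoʳ-≤ x (≤-respʳ (+-identityʳ 1#) (fromℕ-mono (ℕ.≤-pred (m%n<n i 2)))) ⟩
        x + 1#                  ∎))
      where
      d = fromℕ (i % 2)
      x = ψ (i / 2)

  -- Counting van der Corput points below a threshold

  below : Carrier → ℕ → Carrier
  below x j = 𝟙 (ψ j <? x)

  -- Doubling both sides clears the factor ½: ψ(2j) < x becomes ψ(j) < 2x, and ψ(2j+1) < x becomes 1
  -- + ψ(j) < 2x.
  below-double : ∀ {a x c d} → a + a ≈ c → x + x ≈ d → 𝟙 (a <? x) ≈ 𝟙 (c <? d)
  below-double {a} {x} {c} {d} eqa eqx = 𝟙-cong (a <? x) (c <? d)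
    (λ a<x → ≰⇒> λ d≤c → <⇒≱ a<x (x+x≤y+y⇒x≤y (≤-respˡ (sym eqx) (≤-respʳ (sym eqa) d≤c))))
    (λ c<d → ≰⇒> λ x≤a → <⇒≱ c<d (≤-respˡ eqx (≤-respʳ eqa (+-mono-≤ x≤a x≤a))))

  ψ-even-double : ∀ j → ψ (j ℕ.* 2) + ψ (j ℕ.* 2) ≈ ψ j
  ψ-even-double j = trans (+-cong (ψ-even j) (ψ-even j)) (½*x+½*x≈x (ψ j))

  ψ-odd-double : ∀ j → ψ (suc (j ℕ.* 2)) + ψ (suc (j ℕ.* 2)) ≈ 1# + ψ j
  ψ-odd-double j = begin-equality
    ψ (suc (j ℕ.* 2)) + ψ (suc (j ℕ.* 2))   ≈⟨ +-cong (ψ-odd j) (ψ-odd j) ⟩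
    (½ + ½ * ψ j) + (½ + ½ * ψ j)           ≈⟨ solve 2 (λ h x → (h :+ h :* x) :+ (h :+ h :* x) := (h :+ h) :+ (h :* x :+ h :* x)) refl ½ (ψ j) ⟩
    (½ + ½) + (½ * ψ j + ½ * ψ j)           ≈⟨ +-cong ½+½≈1 (½*x+½*x≈x (ψ j)) ⟩
    1# + ψ j                                ∎

  below-even-low : ∀ x j → below x (j ℕ.* 2) ≈ below (x + x) j
  below-even-low x j = below-double (ψ-even-double j) refl

  -- Points with odd index are at least ½, hence never below an x ≤ ½.
  below-odd-low : ∀ x j → x + x ≤ 1# → below x (suc (j ℕ.* 2)) ≈ 0#
  below-odd-low x j p = trans (below-double (ψ-odd-double j) refl)
    (𝟙-no (1# + ψ j <? x + x) λ lt → <⇒≱ lt (≤-trans p (x≤x+y (ψ-nonNegative j))))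

  -- Points with even index are less than ½, hence always below an x ≥ ½.
  below-even-high : ∀ x j → 1# ≤ x + x → below x (j ℕ.* 2) ≈ 1#
  below-even-high x j p = trans (below-even-low x j)
    (𝟙-yes (ψ j <? x + x) (≰⇒> λ q → <⇒≱ (ψ<1 j) (≤-trans p q)))

  below-odd-high : ∀ x y j → x + x ≈ 1# + y → below x (suc (j ℕ.* 2)) ≈ below y j
  below-odd-high x y j eq = trans (below-double (ψ-odd-double j) eq)
    (𝟙-cong (1# + ψ j <? 1# + y) (ψ j <? y)
      (λ p → ≰⇒> λ q → <⇒≱ p (+-monoʳ-≤ 1# q))
      (λ p → ≰⇒> λ q → <⇒≱ p (+-cancelʳ-≤ 1# (≤-respˡ (+-comm _ _) (≤-respʳ (+-comm _ _) q)))))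

  count-low : ∀ x z m → x + x ≤ 1# →
    ∃[ z′ ] sumFrom (below x) z (m ℕ.* 2) ≈ sumFrom (below (x + x)) z′ m
  count-low x z m p with parity z
  ... | even y = y , trans
    (sumFrom-pairs (below x) (ℕ._* 2) (λ _ → ≡.refl) y m)
    (sumFrom-cong (λ j → trans (+-cong (below-even-low x j) (below-odd-low x j p)) (+-identityʳ _)) y m)
  -- A run from 2y + 1 pairs 2j + 1 with 2(j + 1), so its even members are the doubles of a run from
  -- y + 1.
  ... | odd y = suc y , trans
    (sumFrom-pairs (below x) (λ j → suc (j ℕ.* 2)) (λ _ → ≡.refl) y m)
    (sumFrom-cong (λ j → trans (+-cong (below-odd-low x j p) (below-even-low x (suc j))) (+-identityˡ _)) y m)

  count-high : ∀ x y z m → 1# ≤ x + x → x + x ≈ 1# + y →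
    ∃[ z′ ] sumFrom (below x) z (m ℕ.* 2) ≈ fromℕ m + sumFrom (below y) z′ m
  count-high x y z m p eq with parity z
  ... | even k = k , trans
    (sumFrom-pairs (below x) (ℕ._* 2) (λ _ → ≡.refl) k m) (trans
    (sumFrom-cong (λ j → +-cong (below-even-high x j p) (below-odd-high x y j eq)) k m)
    (sumFrom-1+ (below y) k m))
  -- Here the undecided members are the odd ones, 2j + 1, so the halved run starts at `k` for either
  -- parity.
  ... | odd k = k , trans
    (sumFrom-pairs (below x) (λ j → suc (j ℕ.* 2)) (λ _ → ≡.refl) k m) (trans
    (sumFrom-cong (λ j → trans
      (+-cong (below-odd-high x y j eq) (below-even-high x (suc j) p)) (+-comm _ _)) k m)
    (sumFrom-1+ (below y) k m))

  -- b is the leading binary digit of x and x′ = 2x - b: the even and the odd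
  -- members of a run are again runs, and one of the two is decided by b alone.
  count-halve : ∀ x z m → 0# ≤ x → x ≤ 1# →
    ∃[ b ] ∃[ x′ ] ∃[ z′ ] 0# ≤ x′ × x′ ≤ 1# × x + x ≈ b + x′ ×
      sumFrom (below x) z (m ℕ.* 2) ≈ fromℕ m * b + sumFrom (below x′) z′ m
  count-halve x z m 0≤x x≤1 with total (x + x) 1#
  ... | inj₁ p = let z′ , eq = count-low x z m p in
    0# , x + x , z′ , +-nonNegative 0≤x 0≤x , p , sym (+-identityˡ _) ,
    trans eq (sym (trans (+-congʳ (zeroʳ _)) (+-identityˡ _)))
  ... | inj₂ p = let z′ , eq = count-high x (x + x - 1#) z m p 2x≈1+y in
    1# , x + x - 1# , z′ , x≤y⇒0≤y-x p , y≤1 , 2x≈1+y ,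
    trans eq (+-congʳ (sym (*-identityʳ _)))
    where
    2x≈1+y : x + x ≈ 1# + (x + x - 1#)
    2x≈1+y = trans (sym (x-y+y≈x (x + x) 1#)) (+-comm _ _)
    y≤1 : x + x - 1# ≤ 1#
    y≤1 = +-cancelʳ-≤ 1# (≤-respˡ (sym (x-y+y≈x (x + x) 1#)) (+-mono-≤ x≤1 x≤1))

  -- Discrepancy of runs of van der Corput points

  near-+ : ∀ {c d x y u v} → Near c x y → Near d u v → Near (c + d) (x + u) (y + v)
  near-+ (p , q) (r , s) = half p r , half q s
    where
    half : ∀ {c d x y u v} → x ≤ y + c → u ≤ v + d → x + u ≤ (y + v) + (c + d)
    half {c} {d} {x} {y} {u} {v} p r = begin
      x + u             ≤⟨ +-mono-≤ p r ⟩
      (y + c) + (v + d) ≈⟨ solve 4 (λ y c v d → (y :+ c) :+ (v :+ d) := (y :+ v) :+ (c :+ d)) refl y c v d ⟩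
      (y + v) + (c + d) ∎

  near-resp : ∀ {c x x′ y y′} → x ≈ x′ → y ≈ y′ → Near c x y → Near c x′ y′
  near-resp p q (r , s) = ≤-respˡ p (≤-respʳ (+-congʳ q) r) , ≤-respˡ q (≤-respʳ (+-congʳ p) s)

  near-refl : ∀ x → Near 0# x x
  near-refl x = ≤-reflexive (sym (+-identityʳ x)) , ≤-reflexive (sym (+-identityʳ x))

  near-mono : ∀ {c d x y} → c ≤ d → Near c x y → Near d x y
  near-mono c≤d (p , q) = ≤-trans p (+-monoʳ-≤ _ c≤d) , ≤-trans q (+-monoʳ-≤ _ c≤d)

  near-unit : ∀ {x y} → 0# ≤ x → x ≤ 1# → 0# ≤ y → y ≤ 1# → Near 1# x y
  near-unit 0≤x x≤1 0≤y y≤1 = ≤-trans x≤1 (x≤y+x 0≤y) , ≤-trans y≤1 (x≤y+x 0≤x)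

  -- Uniform in the start and in the threshold, because the parity split changes both.
  DiscrepancyBound : ℕ → Carrier → Set
  DiscrepancyBound n c = ∀ z x → 0# ≤ x → x ≤ 1# → Near c (sumFrom (below x) z n) (fromℕ n * x)

  -- The half decided by `b` contributes `m * b` to the count and the same amount to 2m · x, so all
  -- of the error comes from the other half.
  discrepancy-double : ∀ m {c} → DiscrepancyBound m c → DiscrepancyBound (m ℕ.* 2) c
  discrepancy-double m {c} bound z x 0≤x x≤1 with count-halve x z m 0≤x x≤1
  ... | b , x′ , z′ , 0≤x′ , x′≤1 , x+x≈b+x′ , eq =
    near-resp (sym eq) (sym scaled) (near-mono (≤-reflexive (+-identityˡ c))
      (near-+ (near-refl (fromℕ m * b)) (bound z′ x′ 0≤x′ x′≤1)))
    where
    scaled : fromℕ (m ℕ.* 2) * x ≈ fromℕ m * b + fromℕ m * x′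
    scaled = begin-equality
      fromℕ (m ℕ.* 2) * x              ≈⟨ *-congʳ (×1-homo-* m 2) ⟩
      fromℕ m * fromℕ 2 * x            ≈⟨ *-congʳ (*-congˡ (+-congˡ (+-identityʳ 1#))) ⟩
      fromℕ m * (1# + 1#) * x          ≈⟨ solve 3 (λ m i x → m :* (i :+ i) :* x := m :* (i :* x :+ i :* x)) refl (fromℕ m) 1# x ⟩
      fromℕ m * (1# * x + 1# * x)      ≈⟨ *-congˡ (+-cong (*-identityˡ x) (*-identityˡ x)) ⟩
      fromℕ m * (x + x)                ≈⟨ *-congˡ x+x≈b+x′ ⟩
      fromℕ m * (b + x′)               ≈⟨ distribˡ _ _ _ ⟩
      fromℕ m * b + fromℕ m * x′       ∎

  -- The first point adds 0 or 1 to the count and `x` to the expected value, and these differ by at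
  -- most 1.
  discrepancy-suc : ∀ n {c} → DiscrepancyBound n c → DiscrepancyBound (suc n) (1# + c)
  discrepancy-suc n bound z x 0≤x x≤1 = near-resp
    (sym (sumFrom-suc (below x) z n))
    (sym (trans (distribʳ x 1# (fromℕ n)) (+-congʳ (*-identityˡ x))))
    (near-+ (near-unit (𝟙-nonNegative (ψ z <? x)) (𝟙≤1 (ψ z <? x)) 0≤x x≤1) (bound (suc z) x 0≤x x≤1))

  -- s is the number of ones in the binary expansion of n.
  discrepancy : ∀ n → ∃[ s ] 2 ℕ.^ s ℕ.≤ suc n × DiscrepancyBound n (fromℕ s)
  discrepancy = <-rec _ λ n rec → step n (parity n) rec
    where
    Goal : ℕ → Set
    Goal n = ∃[ s ] 2 ℕ.^ s ℕ.≤ suc n × DiscrepancyBound n (fromℕ s)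
    m<m*2 : ∀ k → suc k ℕ.< suc k ℕ.* 2
    m<m*2 k = ℕ.m<m*n (suc k) 2 (s≤s (s≤s z≤n))
    2^suc : ∀ s m → 2 ℕ.^ s ℕ.≤ suc m → 2 ℕ.^ suc s ℕ.≤ suc (suc (m ℕ.* 2))
    2^suc s m p = ≡.subst (2 ℕ.^ suc s ℕ.≤_) (ℕ.*-comm 2 (suc m)) (ℕ.*-monoʳ-≤ 2 p)
    step : ∀ n → Parity n → (∀ {m} → m ℕ.< n → Goal m) → Goal n
    -- Zero is its own half, so the recursion stops here; the empty run has discrepancy 0.
    step _ (even zero) rec = 0 , s≤s z≤n , λ z x _ _ → near-resp refl (sym (zeroˡ x)) (near-refl 0#)
    step _ (even m@(suc k)) rec with rec (m<m*2 k)
    ... | s , p , bound = s , ℕ.≤-trans p (s≤s (ℕ.m≤m*n m 2)) , discrepancy-double m bound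
    step _ (odd m) rec with rec (s≤s (ℕ.m≤m*n m 2))
    -- For n = 2m + 1 the invariant is preserved exactly: 2^s ≤ m + 1 gives 2^(s+1) ≤ 2m + 2 = n +
    -- 1.
    ... | s , p , bound = suc s , 2^suc s m p , discrepancy-suc (m ℕ.* 2) (discrepancy-double m bound)

  -- The quasi-random router

  fromℕ-length-filter-∷ : ∀ {A : Set} {P : Pred A 0ℓ} (P? : Decidable P) x xs →
    fromℕ (length (filter P? (x ∷ xs))) ≈ 𝟙 (P? x) + fromℕ (length (filter P? xs))
  fromℕ-length-filter-∷ P? x xs with P? x
  ... | yes _ = refl
  ... | no _  = sym (+-identityˡ _)

  fromℕ-length-filter-tabulate : ∀ {A : Set} {P : Pred A 0ℓ} (P? : Decidable P) {n} (f : Fin n → A) →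
    fromℕ (length (filter P? (tabulate f))) ≈ sum (λ i → 𝟙 (P? (f i)))
  fromℕ-length-filter-tabulate P? {zero}  f = refl
  fromℕ-length-filter-tabulate P? {suc n} f = trans (fromℕ-length-filter-∷ P? (f zero) _)
    (+-congˡ (fromℕ-length-filter-tabulate P? (f ∘ suc)))

  fromℕ-length-filter-applyUpTo : ∀ {A : Set} {P : Pred A 0ℓ} (P? : Decidable P) (f : ℕ → A) n →
    fromℕ (length (filter P? (applyUpTo f n))) ≈ sum {n} (λ i → 𝟙 (P? (f (toℕ i))))
  fromℕ-length-filter-applyUpTo P? f zero    = refl
  fromℕ-length-filter-applyUpTo P? f (suc n) = trans (fromℕ-length-filter-∷ P? (f 0) _)
    (+-congˡ (fromℕ-length-filter-applyUpTo P? (f ∘ suc) n))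

  ≤𝟙* : ∀ {p} {P : Set p} (P? : Dec P) {x c} → (P → x ≤ c) → (¬ P → x ≤ 0#) → x ≤ 𝟙 P? * c
  ≤𝟙* (yes p) f _ = ≤-respʳ (sym (*-identityˡ _)) (f p)
  ≤𝟙* (no ¬p) _ g = ≤-respʳ (sym (zeroˡ _)) (g ¬p)

  lookup-injective : ∀ {A : Set} {xs : List A} → Unique xs →
                     ∀ i j → lookup xs i ≡ lookup xs j → i ≡ j
  lookup-injective (_ ∷ _)    zero    zero    _  = ≡.refl
  lookup-injective (x∉ ∷ _)   zero    (suc j) eq = contradiction eq (All.lookup x∉ (∈-lookup j))
  lookup-injective (x∉ ∷ _)   (suc i) zero    eq = contradiction (≡.sym eq) (All.lookup x∉ (∈-lookup i))
  lookup-injective (_ ∷ uniq) (suc i) (suc j) eq = ≡.cong suc (lookup-injective uniq i j eq)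

  module _ {A : Set} (p : A → Carrier) where

    total-list : List A → Carrier
    total-list xs = List.foldr _+_ 0# (List.map p xs)

    prefixSum : ℕ → List A → Carrier
    prefixSum k xs = total-list (List.take k xs)

    total-list-↭ : ∀ {xs ys} → xs ↭ ys → total-list xs ≈ total-list ys
    total-list-↭ xs↭ys = SetoidPermutation.foldr-commMonoid setoid +-isCommutativeMonoid
      (↭⇒↭ₛ′ isEquivalence (map⁺ p xs↭ys))

    prefixSum-suc : ∀ xs k → prefixSum (suc (toℕ k)) xs ≈ prefixSum (toℕ k) xs + p (lookup xs k)
    prefixSum-suc (x ∷ xs) zero    = +-comm _ _
    prefixSum-suc (x ∷ xs) (suc k) = trans (+-congˡ (prefixSum-suc xs k)) (sym (+-assoc _ _ _))

    total-list-filter : ∀ {Q : Pred A 0ℓ} (Q? : Decidable Q) → (∀ x → ¬ Q x → p x ≈ 0#) →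
      ∀ {n} (f : Fin n → A) → total-list (filter Q? (tabulate f)) ≈ sum (p ∘ f)
    total-list-filter Q? p≈0 {zero}  f = refl
    total-list-filter Q? p≈0 {suc n} f with Q? (f zero)
    ... | yes _  = +-congˡ (total-list-filter Q? p≈0 (f ∘ suc))
    ... | no ¬q = trans (total-list-filter Q? p≈0 (f ∘ suc))
      (trans (sym (+-identityˡ _)) (+-congʳ (sym (p≈0 _ ¬q))))

    module _ (0≤p : ∀ x → 0# ≤ p x) where

      total-list-nonNegative : ∀ xs → 0# ≤ total-list xs
      total-list-nonNegative []       = ≤-refl
      total-list-nonNegative (x ∷ xs) = +-nonNegative (0≤p x) (total-list-nonNegative xs)

      prefixSum-mono : ∀ {m n} → m ℕ.≤ n → ∀ xs → prefixSum m xs ≤ prefixSum n xs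
      prefixSum-mono {n = n} z≤n     xs       = total-list-nonNegative (List.take n xs)
      prefixSum-mono (s≤s q) []       = ≤-refl
      prefixSum-mono (s≤s q) (x ∷ xs) = +-monoʳ-≤ (p x) (prefixSum-mono q xs)

      prefixSum≤total : ∀ k xs → prefixSum k xs ≤ total-list xs
      prefixSum≤total zero    xs       = total-list-nonNegative xs
      prefixSum≤total (suc k) []       = ≤-refl
      prefixSum≤total (suc k) (x ∷ xs) = +-monoʳ-≤ (p x) (prefixSum≤total k xs)

  module _ {N : ℕ} (P : Matrix N) (stochastic : IsStochastic P) (router : QuasiRandomRouter P) where

    module _ (v : Fin N) where

      private
        0≤P : ∀ u → 0# ≤ P v u
        0≤P = proj₁ (stochastic v)

      order-unique : Unique (order router v)
      order-unique = SetoidPermutation.Unique-resp-↭ (≡.setoid _)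
        (↭⇒↭ₛ (↭-sym (order-↭ router v))) (filter⁺ (λ u → 0# <? P v u) (allFin⁺ N))

      ∈-order⁻ : ∀ {u} → u ∈ order router v → 0# < P v u
      ∈-order⁻ u∈ = proj₂ (∈-filter⁻ (λ u → 0# <? P v u) {xs = List.allFin N} (∈-resp-↭ (order-↭ router v) u∈))

      ∈-order⁺ : ∀ {u} → 0# < P v u → u ∈ order router v
      ∈-order⁺ {u} 0<P = ∈-resp-↭ (↭-sym (order-↭ router v)) (∈-filter⁺ (λ u → 0# <? P v u) (∈-allFin u) 0<P)

      partialSum-nonNegative : ∀ k → 0# ≤ partialSum router v k
      partialSum-nonNegative k = total-list-nonNegative (P v) 0≤P (List.take k (order router v))

      partialSum-mono : ∀ {m n} → m ℕ.≤ n → partialSum router v m ≤ partialSum router v n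
      partialSum-mono m≤n = prefixSum-mono (P v) 0≤P m≤n (order router v)

      -- Keeps the thresholds in the range that `DiscrepancyBound` covers. Passing from `neighbours`
      -- to all vertices adds only zero entries.
      partialSum≤1 : ∀ k → partialSum router v k ≤ 1#
      partialSum≤1 k = begin
        partialSum router v k                 ≤⟨ prefixSum≤total (P v) 0≤P k (order router v) ⟩
        total-list (P v) (order router v)     ≈⟨ total-list-↭ (P v) (order-↭ router v) ⟩
        total-list (P v) (neighbours P v)     ≈⟨ total-list-filter (P v) (λ u → 0# <? P v u)
                                                   (λ u ¬0<P → ≤-antisym (≮⇒≥ ¬0<P) (0≤P u)) (λ u → u) ⟩
        sum (P v)                             ≈⟨ proj₂ (stochastic v) ⟩
        1#                                    ∎

      partialSum-suc : ∀ k → partialSum router v (suc (toℕ k)) ≈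
                             partialSum router v (toℕ k) + P v (lookup (order router v) k)
      partialSum-suc = prefixSum-suc (P v) (order router v)

      -- The half-open interval between consecutive partial sums is a difference of two initial
      -- intervals, written additively. The index given by `σ-spec` is compared with `k`; different
      -- indices hold different vertices because `order` has no repetitions.
      σ-indicator : ∀ k j → 𝟙 (σ router v j Fin.≟ lookup (order router v) k) + below (partialSum router v (toℕ k)) j ≈
                            below (partialSum router v (suc (toℕ k))) j
      σ-indicator k j with σ-spec router v j
      ... | i , lower , upper , σ≡ with ℕ.<-cmp (toℕ i) (toℕ k)
      ...   | tri< i<k i≢k _ = trans (+-cong
        (𝟙-no (σ router v j Fin.≟ _) λ eq → i≢k (≡.cong toℕ (lookup-injective order-unique i k (≡.trans (≡.sym σ≡) eq))))
        (𝟙-yes (ψ j <? _) (≰⇒> λ q → <⇒≱ upper (≤-trans (partialSum-mono i<k) q))))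
        (trans (+-identityˡ 1#) (sym (𝟙-yes (ψ j <? _) (≰⇒> λ q → <⇒≱ upper (≤-trans (partialSum-mono (ℕ.m≤n⇒m≤1+n i<k)) q)))))
      ...   | tri≈ _ i≡k _ = trans (+-cong
        (𝟙-yes (σ router v j Fin.≟ _) (≡.trans σ≡ (≡.cong (lookup (order router v)) (Fin.toℕ-injective i≡k))))
        (𝟙-no (ψ j <? _) λ lt → <⇒≱ lt (≡.subst (λ m → partialSum router v m ≤ ψ j) i≡k lower)))
        (trans (+-identityʳ 1#) (sym (𝟙-yes (ψ j <? _) (≡.subst (λ m → ψ j < partialSum router v (suc m)) i≡k upper))))
      ...   | tri> _ i≢k k<i = trans (+-cong
        (𝟙-no (σ router v j Fin.≟ _) λ eq → i≢k (≡.cong toℕ (lookup-injective order-unique i k (≡.trans (≡.sym σ≡) eq))))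
        (𝟙-no (ψ j <? _) λ lt → <⇒≱ lt (≤-trans (partialSum-mono (ℕ.<⇒≤ k<i)) lower)))
        (trans (+-identityˡ 0#) (sym (𝟙-no (ψ j <? _) λ lt → <⇒≱ lt (≤-trans (partialSum-mono k<i) lower))))

      fromℕ-I : ∀ u z n → fromℕ (I router v u z (z ℕ.+ n)) ≈ sumFrom (λ j → 𝟙 (σ router v j Fin.≟ u)) z n
      fromℕ-I u z n rewrite ℕ.m+n∸m≡n z n =
        fromℕ-length-filter-applyUpTo (λ j → σ router v j Fin.≟ u) (z ℕ.+_) n

      -- Every `j` selects exactly one target, so exchanging the two sums leaves 1 for each `j`.
      sum-I : ∀ z n → sum (λ u → fromℕ (I router v u z (z ℕ.+ n))) ≈ fromℕ n
      sum-I z n = begin-equality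
        sum (λ u → fromℕ (I router v u z (z ℕ.+ n)))      ≈⟨ sum-cong-≋ {N} (λ u → fromℕ-I u z n) ⟩
        sum (λ u → sum {n} λ i → 𝟙 (s i Fin.≟ u))         ≈⟨ ∑-comm {N} {n} (λ u i → 𝟙 (s i Fin.≟ u)) ⟩
        sum {n} (λ i → sum λ u → 𝟙 (s i Fin.≟ u))
          ≈⟨ sum-cong-≋ {n} (λ i → trans (sum-cong-≋ {N} (λ u → sym (*-identityʳ _))) (sum-𝟙* (λ _ → 1#) (s i))) ⟩
        sum {n} (λ _ → 1#)                                ≈⟨ sum-1 n ⟩
        fromℕ n                                           ∎
        where
        s : Fin n → Fin N
        s i = σ router v (z ℕ.+ toℕ i)

      -- The count is the difference of the counts below the thresholds `b` and `a`, each of which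
      -- is off by at most `c`.
      I-near : ∀ k z n {c} → DiscrepancyBound n c →
        Near (c + c) (fromℕ (I router v (lookup (order router v) k) z (z ℕ.+ n))) (fromℕ n * P v (lookup (order router v) k))
      I-near k z n {c} bound = +-cancelʳ-≤ A (begin
          x + A                           ≈⟨ x+A≈B ⟩
          B                               ≤⟨ proj₁ nearB ⟩
          fromℕ n * b + c                 ≈⟨ +-congʳ nb≈na+np ⟩
          fromℕ n * a + y + c             ≤⟨ +-mono-≤ (+-mono-≤ (proj₂ nearA) ≤-refl) ≤-refl ⟩
          A + c + y + c                   ≈⟨ solve 3 (λ A c y → A :+ c :+ y :+ c := y :+ (c :+ c) :+ A) refl A c y ⟩
          y + (c + c) + A                 ∎)
        , +-cancelʳ-≤ (fromℕ n * a) (begin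
          y + fromℕ n * a                 ≈⟨ trans (+-comm _ _) (sym nb≈na+np) ⟩
          fromℕ n * b                     ≤⟨ proj₂ nearB ⟩
          B + c                           ≈⟨ +-congʳ x+A≈B ⟨
          x + A + c                       ≤⟨ +-mono-≤ (+-monoʳ-≤ x (proj₁ nearA)) ≤-refl ⟩
          x + (fromℕ n * a + c) + c       ≈⟨ solve 3 (λ x na c → x :+ (na :+ c) :+ c := x :+ (c :+ c) :+ na) refl x (fromℕ n * a) c ⟩
          x + (c + c) + fromℕ n * a       ∎)
        where
        u = lookup (order router v) k
        a = partialSum router v (toℕ k)
        b = partialSum router v (suc (toℕ k))
        A = sumFrom (below a) z n
        B = sumFrom (below b) z n
        x = fromℕ (I router v u z (z ℕ.+ n))
        y = fromℕ n * P v u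
        nearA : Near c A (fromℕ n * a)
        nearA = bound z a (partialSum-nonNegative (toℕ k)) (partialSum≤1 (toℕ k))
        nearB : Near c B (fromℕ n * b)
        nearB = bound z b (partialSum-nonNegative (suc (toℕ k))) (partialSum≤1 (suc (toℕ k)))
        nb≈na+np : fromℕ n * b ≈ fromℕ n * a + y
        nb≈na+np = trans (*-congˡ (partialSum-suc k)) (distribˡ _ _ _)
        x+A≈B : x + A ≈ B
        x+A≈B = begin-equality
          x + A                                              ≈⟨ +-congʳ (fromℕ-I u z n) ⟩
          sumFrom (λ j → 𝟙 (σ router v j Fin.≟ u)) z n + A
            ≈⟨ ∑-distrib-+ {n} (λ i → 𝟙 (σ router v (z ℕ.+ toℕ i) Fin.≟ u)) (λ i → below a (z ℕ.+ toℕ i)) ⟨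
          sumFrom (λ j → 𝟙 (σ router v j Fin.≟ u) + below a j) z n ≈⟨ sumFrom-cong (σ-indicator k) z n ⟩
          B                                                  ∎

      -- The indicator is retained so that a later sum over edges produces a degree; along a
      -- non-edge the count and its expected value both vanish.
      I-error : ∀ u z n {c} → DiscrepancyBound n c →
        ∣ fromℕ (I router v u z (z ℕ.+ n)) - fromℕ n * P v u ∣ ≤ 𝟙 (0# <? P v u) * (c + c)
      I-error u z n {c} bound = ≤𝟙* (0# <? P v u)
        -- `I-near` speaks of positions in `order`; membership of `u` supplies one, together with
        -- the equation that carries the bound back to `u`.
        (λ 0<P → ≡.subst (λ u → ∣ fromℕ (I router v u z (z ℕ.+ n)) - fromℕ n * P v u ∣ ≤ c + c)
          (≡.sym (Any.lookup-index (∈-order⁺ 0<P))) (near⇒∣-∣≤ (I-near (Any.index (∈-order⁺ 0<P)) z n bound)))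
        (λ ¬0<P → near⇒∣-∣≤ (near-resp (sym (I≈0 ¬0<P)) (sym (nP≈0 ¬0<P)) (near-refl 0#)))
        where
        σ≢u : ¬ 0# < P v u → ∀ j → ¬ σ router v j ≡ u
        σ≢u ¬0<P j ≡.refl with σ-spec router v j
        ... | k , _ , _ , σ≡ = ¬0<P (∈-order⁻ (≡.subst (_∈ order router v) (≡.sym σ≡) (∈-lookup k)))
        I≈0 : ¬ 0# < P v u → fromℕ (I router v u z (z ℕ.+ n)) ≈ 0#
        I≈0 ¬0<P = trans (fromℕ-I u z n)
          (trans (sumFrom-cong (λ j → 𝟙-no (σ router v j Fin.≟ u) (σ≢u ¬0<P j)) z n) (sum-replicate-zero n))
        nP≈0 : ¬ 0# < P v u → fromℕ n * P v u ≈ 0#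
        nP≈0 ¬0<P = trans (*-congˡ (≤-antisym (≮⇒≥ ¬0<P) (0≤P u))) (zeroʳ _)

  -- Markov chains

  infixl 7 _▷_
  -- Row vector times matrix. Both `matrixPower P (suc t) u` and `μ` have this shape by definition.
  _▷_ : ∀ {N} → Vector Carrier N → Matrix N → Vector Carrier N
  (ξ ▷ Q) w = sum λ v → ξ v * Q v w

  module _ {N : ℕ} where

    ▷-congˡ : ∀ {ξ ζ : Vector Carrier N} → (∀ v → ξ v ≈ ζ v) → ∀ Q w → (ξ ▷ Q) w ≈ (ζ ▷ Q) w
    ▷-congˡ ξ≈ζ Q w = sum-cong-≋ {N} (λ v → *-congʳ (ξ≈ζ v))

    ▷-assoc : ∀ (ξ : Vector Carrier N) (Q R : Matrix N) w →
              ((ξ ▷ Q) ▷ R) w ≈ (ξ ▷ λ v → Q v ▷ R) w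
    ▷-assoc ξ Q R w = begin-equality
      sum (λ u → (ξ ▷ Q) u * R u w)
        ≈⟨ sum-cong-≋ {N} (λ u → *-distribʳ-sum {N} (R u w) (λ v → ξ v * Q v u)) ⟩
      sum (λ u → sum λ v → ξ v * Q v u * R u w)
        ≈⟨ ∑-comm {N} {N} (λ u v → ξ v * Q v u * R u w) ⟩
      sum (λ v → sum λ u → ξ v * Q v u * R u w)
        ≈⟨ sum-cong-≋ {N} (λ v → trans (sum-cong-≋ {N} (λ u → *-assoc (ξ v) (Q v u) (R u w)))
             (sym (*-distribˡ-sum {N} (ξ v) (λ u → Q v u * R u w)))) ⟩
      sum (λ v → ξ v * (Q v ▷ R) w) ∎

    ▷-sub : ∀ (ξ ζ : Vector Carrier N) Q w → ((λ v → ξ v - ζ v) ▷ Q) w ≈ (ξ ▷ Q) w - (ζ ▷ Q) w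
    ▷-sub ξ ζ Q w = trans (sum-cong-≋ {N} (λ v → *-distribʳ-sub (ξ v) (ζ v) (Q v w)))
      (sum-sub {N} (λ v → ξ v * Q v w) (λ v → ζ v * Q v w))

    -- Subtracting one `ζ` from every row changes the product by `sum ξ * ζ w`, which is 0.
    ▷-shift : ∀ (ξ : Vector Carrier N) → sum ξ ≈ 0# → ∀ Q (ζ : Vector Carrier N) w →
              (ξ ▷ Q) w ≈ (ξ ▷ λ v u → Q v u - ζ u) w
    ▷-shift ξ ∑ξ≈0 Q ζ w = sym (begin-equality
      sum (λ v → ξ v * (Q v w - ζ w))             ≈⟨ sum-cong-≋ {N} (λ v → *-distribˡ-sub (ξ v) (Q v w) (ζ w)) ⟩
      sum (λ v → ξ v * Q v w - ξ v * ζ w)         ≈⟨ sum-sub {N} (λ v → ξ v * Q v w) (λ v → ξ v * ζ w) ⟩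
      (ξ ▷ Q) w - sum (λ v → ξ v * ζ w)           ≈⟨ +-congˡ (-‿cong (sym (*-distribʳ-sum {N} (ζ w) ξ))) ⟩
      (ξ ▷ Q) w - sum ξ * ζ w                     ≈⟨ +-congˡ (-‿cong (trans (*-congʳ ∑ξ≈0) (zeroˡ (ζ w)))) ⟩
      (ξ ▷ Q) w - 0#                              ≈⟨ trans (+-congˡ -0#≈0#) (+-identityʳ _) ⟩
      (ξ ▷ Q) w                                   ∎)

    ∣▷∣≤ : ∀ (ξ : Vector Carrier N) Q w → ∣ (ξ ▷ Q) w ∣ ≤ sum (λ v → ∣ ξ v ∣ * ∣ Q v w ∣)
    ∣▷∣≤ ξ Q w = ≤-trans (∣sum∣≤sum∣∣ {N} (λ v → ξ v * Q v w)) (sum-mono {N} (λ v → ∣x*y∣≤∣x∣*∣y∣ (ξ v) (Q v w)))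

    sum-▷ : ∀ (ξ : Vector Carrier N) Q → sum (ξ ▷ Q) ≈ sum (λ v → ξ v * sum (Q v))
    sum-▷ ξ Q = trans (∑-comm {N} {N} (λ w v → ξ v * Q v w))
      (sum-cong-≋ {N} (λ v → sym (*-distribˡ-sum {N} (ξ v) (Q v))))

    -- The ℓ¹ operator norm on row vectors is controlled by absolute row sums: `c` is 1 for a
    -- stochastic matrix and ½ for the deviation from π at the mixing rate.
    ‖▷‖≤ : ∀ (ξ : Vector Carrier N) Q {c} → (∀ v → sum (λ w → ∣ Q v w ∣) ≤ c) →
           sum (λ w → ∣ (ξ ▷ Q) w ∣) ≤ c * sum (λ v → ∣ ξ v ∣)
    ‖▷‖≤ ξ Q {c} Q≤c = begin
      sum (λ w → ∣ (ξ ▷ Q) w ∣)                       ≤⟨ sum-mono {N} (∣▷∣≤ ξ Q) ⟩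
      sum ((λ v → ∣ ξ v ∣) ▷ (λ v w → ∣ Q v w ∣))     ≈⟨ sum-▷ (λ v → ∣ ξ v ∣) (λ v w → ∣ Q v w ∣) ⟩
      sum (λ v → ∣ ξ v ∣ * sum (λ w → ∣ Q v w ∣))     ≤⟨ sum-mono {N} (λ v → *-monoˡ-≤ (0≤∣x∣ (ξ v)) (Q≤c v)) ⟩
      sum (λ v → ∣ ξ v ∣ * c)                         ≈⟨ *-distribʳ-sum {N} c (λ v → ∣ ξ v ∣) ⟨
      sum (λ v → ∣ ξ v ∣) * c                         ≈⟨ *-comm _ c ⟩
      c * sum (λ v → ∣ ξ v ∣)                         ∎

    module _ (P : Matrix N) where

      ▷-power-zero : ∀ (ξ : Vector Carrier N) w → (ξ ▷ matrixPower P 0) w ≈ ξ w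
      ▷-power-zero ξ w = trans
        (sum-cong-≋ {N} (λ v → trans (*-comm (ξ v) _) (*-congʳ (𝟙-cong (v Fin.≟ w) (w Fin.≟ v) ≡.sym ≡.sym))))
        (sum-𝟙* ξ w)

      power-+ : ∀ t s u w → matrixPower P (t ℕ.+ s) u w ≈ (matrixPower P s u ▷ matrixPower P t) w
      power-+ zero    s u w = sym (▷-power-zero (matrixPower P s u) w)
      power-+ (suc t) s u w = trans (▷-congˡ (power-+ t s u) P w)
        (▷-assoc (matrixPower P s u) (matrixPower P t) P w)

      -- Powers are defined by multiplication on the right, whereas telescoping and reversal take a
      -- factor off on the left.
      power-sucˡ : ∀ t u w → matrixPower P (suc t) u w ≈ (P u ▷ matrixPower P t) w
      power-sucˡ t u w = begin-equality
        matrixPower P (suc t) u w                         ≈⟨ reflexive (≡.cong (λ k → matrixPower P k u w) (ℕ.+-comm 1 t)) ⟩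
        matrixPower P (t ℕ.+ 1) u w                       ≈⟨ power-+ t 1 u w ⟩
        (matrixPower P 1 u ▷ matrixPower P t) w           ≈⟨ ▷-congˡ (λ v → sum-𝟙* (λ x → P x v) u) (matrixPower P t) w ⟩
        (P u ▷ matrixPower P t) w                         ∎

      ▷-power-suc : ∀ (ξ : Vector Carrier N) t w → (ξ ▷ matrixPower P (suc t)) w ≈ ((ξ ▷ P) ▷ matrixPower P t) w
      ▷-power-suc ξ t w = trans (sum-cong-≋ {N} (λ v → *-congˡ (power-sucˡ t v w)))
        (sym (▷-assoc ξ P (matrixPower P t) w))

  module _ {N : ℕ} (P : Matrix N) (stochastic : IsStochastic P) where

    sum-▷-stochastic : ∀ (ξ : Vector Carrier N) → sum (ξ ▷ P) ≈ sum ξ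
    sum-▷-stochastic ξ = trans (sum-▷ ξ P)
      (sum-cong-≋ {N} (λ v → trans (*-congˡ (proj₂ (stochastic v))) (*-identityʳ (ξ v))))

    power-stochastic : ∀ t → IsStochastic (matrixPower P t)
    power-stochastic zero    u = (λ v → 𝟙-nonNegative (u Fin.≟ v)) ,
      trans (sum-cong-≋ {N} (λ v → sym (*-identityʳ _))) (sum-𝟙* (λ _ → 1#) u)
    power-stochastic (suc t) u =
      (λ v → sum-nonNegative {N} (λ w → *-nonNegative (proj₁ (power-stochastic t u) w) (proj₁ (stochastic w) v))) ,
      trans (sum-▷-stochastic (matrixPower P t u)) (proj₂ (power-stochastic t u))

  module _ {N : ℕ} (P : Matrix N) (π : Vector Carrier N)
           (stochastic : IsStochastic P) (stationary : IsStationary P π) where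

    stationary-power : ∀ t w → (π ▷ matrixPower P t) w ≈ π w
    stationary-power zero    w = ▷-power-zero P π w
    stationary-power (suc t) w = trans (▷-power-suc P π t w)
      (trans (▷-congˡ (proj₂ stationary) (matrixPower P t) w) (stationary-power t w))

    -- Each π_u · P^t_{u,w} is a term of (π P^t)_w = π_w. If π_w ≤ 0, choosing `t` with P^t_{u,w} >
    -- 0 forces π_u = 0 for every `u`, against total mass 1.
    stationary-positive : IsIrreducible P → ∀ w → 0# < π w
    stationary-positive irreducible w = ≰⇒> λ πw≤0 → 0≉1 (begin-equality
      0#                    ≈⟨ sum-replicate-zero N ⟨
      sum {N} (λ _ → 0#)    ≈⟨ sum-cong-≋ {N} (λ u → sym (vanishes πw≤0 u)) ⟩
      sum π                 ≈⟨ proj₂ (proj₁ stationary) ⟩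
      1#                    ∎)
      where
      0≤π = proj₁ (proj₁ stationary)
      vanishes : π w ≤ 0# → ∀ u → π u ≈ 0#
      vanishes πw≤0 u with irreducible u w
      ... | t , 0<Pᵗuw = ≤-antisym (≮⇒≥ λ 0<πu → <⇒≱ (*-positive 0<πu 0<Pᵗuw) (begin
        π u * matrixPower P t u w
          ≤⟨ term≤sum {N} (λ v → *-nonNegative (0≤π v) (proj₁ (power-stochastic P stochastic t v) w)) u ⟩
        (π ▷ matrixPower P t) w       ≈⟨ stationary-power t w ⟩
        π w                           ≤⟨ πw≤0 ⟩
        0#                            ∎)) (0≤π u)

    -- Moving π across one factor at a time reverses the order of the factors, so the last step of
    -- one path becomes the first step of the reversed one.
    reversible-power : IsReversible P π → ∀ t u w → π u * matrixPower P t u w ≈ π w * matrixPower P t w u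
    reversible-power reversible zero u w with u Fin.≟ w
    ... | yes ≡.refl = *-congˡ (sym (𝟙-yes (u Fin.≟ u) ≡.refl))
    ... | no u≢w = trans (zeroʳ _) (sym (trans (*-congˡ (𝟙-no (w Fin.≟ u) (u≢w ∘ ≡.sym))) (zeroʳ _)))
    reversible-power reversible (suc t) u w = begin-equality
      π u * sum (λ x → matrixPower P t u x * P x w)
        ≈⟨ *-distribˡ-sum {N} (π u) (λ x → matrixPower P t u x * P x w) ⟩
      sum (λ x → π u * (matrixPower P t u x * P x w))
        ≈⟨ sum-cong-≋ {N} move ⟩
      sum (λ x → π w * (P w x * matrixPower P t x u))
        ≈⟨ *-distribˡ-sum {N} (π w) (λ x → P w x * matrixPower P t x u) ⟨
      π w * (P w ▷ matrixPower P t) u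
        ≈⟨ *-congˡ (power-sucˡ P t w u) ⟨
      π w * matrixPower P (suc t) w u ∎
      where
      move : ∀ x → π u * (matrixPower P t u x * P x w) ≈ π w * (P w x * matrixPower P t x u)
      move x = begin-equality
        π u * (matrixPower P t u x * P x w)   ≈⟨ *-assoc _ _ _ ⟨
        π u * matrixPower P t u x * P x w     ≈⟨ *-congʳ (reversible-power reversible t u x) ⟩
        π x * matrixPower P t x u * P x w     ≈⟨ solve 3 (λ a b c → a :* b :* c := a :* c :* b) refl (π x) (matrixPower P t x u) (P x w) ⟩
        π x * P x w * matrixPower P t x u     ≈⟨ *-congʳ (reversible x w) ⟩
        π w * P w x * matrixPower P t x u     ≈⟨ *-assoc _ _ _ ⟩
        π w * (P w x * matrixPower P t x u)   ∎

  -- Extrema, degrees and the binary logarithm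

  minimum≤ : ∀ {n} (f : Vector Carrier (suc n)) i → minimum f ≤ f i
  minimum≤ f i = All.tabulate⁻ {f = f} (Extrema.min≤xs (f zero) (tabulate f)) i

  minimum-positive : ∀ {n} (f : Vector Carrier (suc n)) → (∀ i → 0# < f i) → 0# < minimum f
  minimum-positive f 0<f = Extrema.argmin-all (λ x → x) {f zero} {tabulate f} {0# <_} (0<f zero) (All.tabulate⁺ 0<f)

  ≤maximumℕ : ∀ {n} (f : Vector ℕ n) i → f i ℕ.≤ maximumℕ f
  ≤maximumℕ f i = All.tabulate⁻ {f = f} (ℕExtrema.xs≤max 0 (tabulate f)) i

  fromℕ-degree : ∀ {N} (P : Matrix N) v → fromℕ (degree P v) ≈ sum (λ u → 𝟙 (0# <? P v u))
  fromℕ-degree P v = fromℕ-length-filter-tabulate (λ u → 0# <? P v u) (λ u → u)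

  -- The rational s / 1 belongs to the cut whose supremum is `lg (suc M)`.
  2^s≤1+M⇒s≤lg : ∀ s M → 2 ℕ.^ s ℕ.≤ suc M → fromℕ s ≤ lg (suc M)
  2^s≤1+M⇒s≤lg s M p = ≤-respˡ s÷1≈s (proj₁ (proj₂ (complete (Lg-Cut (suc M)) _ _)) (fromℕ s ÷ fromℕ 1)
    (s , 1 , _ , ≡.subst (2 ℕ.^ s ℕ.≤_) (≡.sym (ℕ.^-identityʳ (suc M))) p , refl))
    where
    s÷1≈s : fromℕ s ÷ fromℕ 1 ≈ fromℕ s
    s÷1≈s = begin-equality
      fromℕ s * fromℕ 1 ⁻¹               ≈⟨ *-congʳ (trans (*-congˡ (+-identityʳ 1#)) (*-identityʳ _)) ⟨
      fromℕ s * fromℕ 1 * fromℕ 1 ⁻¹     ≈⟨ *-assoc _ _ _ ⟩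
      fromℕ s * (fromℕ 1 * fromℕ 1 ⁻¹)   ≈⟨ *-congˡ (*-inverseʳ (fromℕ 1) (fromℕ-suc≉0 0)) ⟩
      fromℕ s * 1#                       ≈⟨ *-identityʳ _ ⟩
      fromℕ s                            ∎

  -- Distance to stationarity

  module _ {N : ℕ} (P : Matrix N) (π : Vector Carrier N)
           (stochastic : IsStochastic P) (stationary : IsStationary P π) where

    -- The ℓ¹ norm, twice the total variation distance; hence the bounds 2 and ½ in place of 1 and
    -- ¼.
    distance : Fin N → ℕ → Carrier
    distance v t = sum λ u → ∣ matrixPower P t v u - π u ∣

    distance-nonNegative : ∀ v t → 0# ≤ distance v t
    distance-nonNegative v t = sum-nonNegative {N} (λ u → 0≤∣x∣ (matrixPower P t v u - π u))

    distance≤2 : ∀ v t → distance v t ≤ fromℕ 2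
    distance≤2 v t = begin
      distance v t
        ≤⟨ sum-mono {N} (λ u → ∣x-y∣≤x+y (proj₁ (power-stochastic P stochastic t v) u) (proj₁ (proj₁ stationary) u)) ⟩
      sum (λ u → matrixPower P t v u + π u)
        ≈⟨ ∑-distrib-+ {N} (matrixPower P t v) π ⟩
      sum (matrixPower P t v) + sum π
        ≈⟨ +-cong (proj₂ (power-stochastic P stochastic t v)) (trans (proj₂ (proj₁ stationary)) (sym (+-identityʳ 1#))) ⟩
      fromℕ 2 ∎

    deviation-sum : ∀ v t → sum (λ u → matrixPower P t v u - π u) ≈ 0#
    deviation-sum v t = trans (sum-sub {N} (matrixPower P t v) π)
      (trans (sub-cong (proj₂ (power-stochastic P stochastic t v)) (proj₂ (proj₁ stationary))) (-‿inverseʳ 1#))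

    -- Since π P^t = π, the deviation from π itself evolves under P^t.
    deviation-+ : ∀ v t s w → matrixPower P (t ℕ.+ s) v w - π w ≈
                  ((λ u → matrixPower P s v u - π u) ▷ matrixPower P t) w
    deviation-+ v t s w = trans
      (sub-cong (power-+ P t s v w) (sym (stationary-power P π stochastic stationary t w)))
      (sym (▷-sub (matrixPower P s v) π (matrixPower P t) w))

    distance-antitone : ∀ v t s → distance v (t ℕ.+ s) ≤ distance v s
    distance-antitone v t s = begin
      distance v (t ℕ.+ s)
        ≈⟨ sum-cong-≋ {N} (λ w → ∣∣-cong (deviation-+ v t s w)) ⟩
      sum (λ w → ∣ ((λ u → matrixPower P s v u - π u) ▷ matrixPower P t) w ∣)
        ≤⟨ ‖▷‖≤ (λ u → matrixPower P s v u - π u) (matrixPower P t) row ⟩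
      1# * distance v s
        ≈⟨ *-identityˡ _ ⟩
      distance v s ∎
      where
      row : ∀ u → sum (λ w → ∣ matrixPower P t u w ∣) ≤ 1#
      row u = ≤-reflexive (trans
        (sum-cong-≋ {N} (λ w → 0≤x⇒∣x∣≈x (proj₁ (power-stochastic P stochastic t u) w)))
        (proj₂ (power-stochastic P stochastic t u)))

    -- The deviation has mass 0, so P^t may be replaced by its own deviation from π, whose rows have
    -- norm at most `c`.
    distance-contract : ∀ {c} t → (∀ v → distance v t ≤ c) → ∀ v s → distance v (t ℕ.+ s) ≤ c * distance v s
    distance-contract {c} t bound v s = begin
      distance v (t ℕ.+ s)
        ≈⟨ sum-cong-≋ {N} (λ w → ∣∣-cong (trans (deviation-+ v t s w)
             (▷-shift (λ u → matrixPower P s v u - π u) (deviation-sum v s) (matrixPower P t) π w))) ⟩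
      sum (λ w → ∣ ((λ u → matrixPower P s v u - π u) ▷ (λ u w → matrixPower P t u w - π w)) w ∣)
        ≤⟨ ‖▷‖≤ (λ u → matrixPower P s v u - π u) (λ u w → matrixPower P t u w - π w) bound ⟩
      c * distance v s ∎

    -- The hypothesis gives ¼ in total variation at the time `τ v` belonging to `v`; monotonicity
    -- bridges the gap to the maximum over all vertices.
    distance-mixed : ∀ {t*} → IsMixingRate P π t* → ∀ v → distance v t* ≤ ½
    distance-mixed (τ , least , ≡.refl) v with ℕ.m≤n⇒∃[o]m+o≡n (≤maximumℕ τ v)
    ... | k , τ+k≡t* = begin
      distance v (maximumℕ τ)        ≈⟨ reflexive (≡.cong (distance v) (≡.trans (≡.sym τ+k≡t*) (ℕ.+-comm (τ v) k))) ⟩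
      distance v (k ℕ.+ τ v)         ≤⟨ distance-antitone v k (τ v) ⟩
      distance v (τ v)               ≈⟨ ½*x+½*x≈x _ ⟨
      ½ * distance v (τ v) + ½ * distance v (τ v)
                                     ≤⟨ +-mono-≤ (proj₁ (least v)) (proj₁ (least v)) ⟩
      ¼ + ¼                          ≈⟨ ¼+¼≈½ ⟩
      ½                              ∎

    sum-distance : ∀ {t*} → IsMixingRate P π t* → ∀ v T → sumFrom (distance v) 0 T ≤ fromℕ 3 * fromℕ t*
    sum-distance {t*} mixing v = sumFrom-halving (distance v) t* (distance-nonNegative v) (distance≤2 v)
      (λ j → ≤-respˡ (reflexive (≡.cong (distance v) (ℕ.+-comm j t*)))
        (≤-trans (distance-antitone v j t*) (distance-mixed mixing v)))
      (λ j → distance-contract t* (distance-mixed mixing) v j)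

  -- The routing error and its propagation

  module _ {N : ℕ} (P : Matrix N) (stochastic : IsStochastic P)
           (router : QuasiRandomRouter P) (χ₀ : Vector ℕ N) where

    tokens : ℕ → Vector Carrier N
    tokens t v = fromℕ (χ router χ₀ t v)

    tokens-suc : ∀ t u → tokens (suc t) u ≈ sum (λ v → fromℕ (Z router χ₀ t v u))
    tokens-suc t u = fromℕ-∑ (λ v → Z router χ₀ t v u)

    sum-tokens : ∀ t → sum (tokens t) ≈ fromℕ (∑ℕ χ₀)
    sum-tokens zero    = sym (fromℕ-∑ χ₀)
    sum-tokens (suc t) = begin-equality
      sum (tokens (suc t))                              ≈⟨ sum-cong-≋ {N} (tokens-suc t) ⟩
      sum (λ u → sum λ v → fromℕ (Z router χ₀ t v u))   ≈⟨ ∑-comm {N} {N} (λ u v → fromℕ (Z router χ₀ t v u)) ⟩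
      sum (λ v → sum λ u → fromℕ (Z router χ₀ t v u))
        ≈⟨ sum-cong-≋ {N} (λ v → sum-I P stochastic router v (served router χ₀ t v) (χ router χ₀ t v)) ⟩
      sum (tokens t)                                    ≈⟨ sum-tokens t ⟩
      fromℕ (∑ℕ χ₀)                                     ∎

    -- Tokens are conserved, and no vertex holds more than all of them.
    χ≤∑χ₀ : ∀ t v → χ router χ₀ t v ℕ.≤ ∑ℕ χ₀
    χ≤∑χ₀ t v = fromℕ-cancel-≤ (≤-respʳ (sum-tokens t)
      (term≤sum {N} (λ u → fromℕ-nonNegative (χ router χ₀ t u)) v))

    routingError : ℕ → Vector Carrier N
    routingError t u = tokens (suc t) u - (tokens t ▷ P) u

    sum-routingError : ∀ t → sum (routingError t) ≈ 0#
    sum-routingError t = begin-equality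
      sum (routingError t)                              ≈⟨ sum-sub {N} (tokens (suc t)) (tokens t ▷ P) ⟩
      sum (tokens (suc t)) - sum (tokens t ▷ P)
        ≈⟨ sub-cong (sum-tokens (suc t)) (trans (sum-▷-stochastic P stochastic (tokens t)) (sum-tokens t)) ⟩
      fromℕ (∑ℕ χ₀) - fromℕ (∑ℕ χ₀)                     ≈⟨ -‿inverseʳ _ ⟩
      0#                                                ∎

    Z-error : ∀ t v u → ∣ fromℕ (Z router χ₀ t v u) - tokens t v * P v u ∣ ≤
                        𝟙 (0# <? P v u) * (lg (suc (∑ℕ χ₀)) + lg (suc (∑ℕ χ₀)))
    Z-error t v u with discrepancy (χ router χ₀ t v)
    ... | s , 2^s≤ , bound = ≤-trans (I-error P stochastic router v u (served router χ₀ t v) (χ router χ₀ t v) bound)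
      (*-monoˡ-≤ (𝟙-nonNegative (0# <? P v u)) (+-mono-≤ s≤lg s≤lg))
      where
      s≤lg : fromℕ s ≤ lg (suc (∑ℕ χ₀))
      s≤lg = 2^s≤1+M⇒s≤lg s (∑ℕ χ₀) (ℕ.≤-trans 2^s≤ (s≤s (χ≤∑χ₀ t v)))

    0≤lg : 0# ≤ lg (suc (∑ℕ χ₀))
    0≤lg = 2^s≤1+M⇒s≤lg 0 (∑ℕ χ₀) (s≤s z≤n)

    module _ (symmetric : ∀ {u v} → 0# < P u v → 0# < P v u) where

      errorBound : Carrier
      errorBound = fromℕ (maxDegree P) * (lg (suc (∑ℕ χ₀)) + lg (suc (∑ℕ χ₀)))

      errorBound-nonNegative : 0# ≤ errorBound
      errorBound-nonNegative = *-nonNegative (fromℕ-nonNegative (maxDegree P)) (+-nonNegative 0≤lg 0≤lg)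

      -- The error at `u` collects the edges into `u`; `symmetric` makes their number the out-degree
      -- of `u`, which is at most Δ.
      ∣routingError∣≤ : ∀ t u → ∣ routingError t u ∣ ≤ errorBound
      ∣routingError∣≤ t u = begin
        ∣ tokens (suc t) u - (tokens t ▷ P) u ∣
          ≈⟨ ∣∣-cong (trans (sub-cong (tokens-suc t u) refl)
               (sym (sum-sub {N} (λ v → fromℕ (Z router χ₀ t v u)) (λ v → tokens t v * P v u)))) ⟩
        ∣ sum (λ v → fromℕ (Z router χ₀ t v u) - tokens t v * P v u) ∣
          ≤⟨ ∣sum∣≤sum∣∣ {N} (λ v → fromℕ (Z router χ₀ t v u) - tokens t v * P v u) ⟩
        sum (λ v → ∣ fromℕ (Z router χ₀ t v u) - tokens t v * P v u ∣)
          ≤⟨ sum-mono {N} (λ v → Z-error t v u) ⟩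
        sum (λ v → 𝟙 (0# <? P v u) * (L + L))
          ≈⟨ *-distribʳ-sum {N} (L + L) (λ v → 𝟙 (0# <? P v u)) ⟨
        sum (λ v → 𝟙 (0# <? P v u)) * (L + L)
          ≈⟨ *-congʳ (trans (fromℕ-degree P u) (sum-cong-≋ {N} (λ v → 𝟙-cong (0# <? P u v) (0# <? P v u) symmetric symmetric))) ⟨
        fromℕ (degree P u) * (L + L)
          ≤⟨ *-monoʳ-≤ (+-nonNegative 0≤lg 0≤lg) (fromℕ-mono (≤maximumℕ (degree P) u)) ⟩
        errorBound ∎
        where L = lg (suc (∑ℕ χ₀))

      module _ (π : Vector Carrier N) (w : Fin N) (r : Carrier) (d : ℕ → Carrier)
               (column : ∀ s → sum (λ u → ∣ matrixPower P s u w - π w ∣) ≤ r * d s) where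

        -- A uniform bound on the error is paired with an ℓ¹ bound on column `w` of the deviation,
        -- kept abstract as `r * d s`.
        ∣routingError▷∣≤ : ∀ t s → ∣ (routingError t ▷ matrixPower P s) w ∣ ≤ errorBound * r * d s
        ∣routingError▷∣≤ t s = begin
          ∣ (routingError t ▷ matrixPower P s) w ∣
            ≈⟨ ∣∣-cong (▷-shift (routingError t) (sum-routingError t) (matrixPower P s) π w) ⟩
          ∣ (routingError t ▷ (λ u w → matrixPower P s u w - π w)) w ∣
            ≤⟨ ∣▷∣≤ (routingError t) (λ u w → matrixPower P s u w - π w) w ⟩
          sum (λ u → ∣ routingError t u ∣ * ∣ matrixPower P s u w - π w ∣)
            ≤⟨ sum-mono {N} (λ u → *-monoʳ-≤ (0≤∣x∣ (matrixPower P s u w - π w)) (∣routingError∣≤ t u)) ⟩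
          sum (λ u → errorBound * ∣ matrixPower P s u w - π w ∣)
            ≈⟨ *-distribˡ-sum {N} errorBound (λ u → ∣ matrixPower P s u w - π w ∣) ⟨
          errorBound * sum (λ u → ∣ matrixPower P s u w - π w ∣)
            ≤⟨ *-monoˡ-≤ errorBound-nonNegative (column s) ⟩
          errorBound * (r * d s)
            ≈⟨ *-assoc _ _ _ ⟨
          errorBound * r * d s ∎

        -- `s` is free because each induction step trades the latest time step for one more power of
        -- `P`: `T` drops, `s` grows, and the total exponent is unchanged.
        telescope : ∀ T s → ∣ (tokens T ▷ matrixPower P s) w - (tokens 0 ▷ matrixPower P (T ℕ.+ s)) w ∣ ≤
                            errorBound * r * sumFrom d s T
        telescope zero    s = ≤-respʳ (sym (zeroʳ _)) (near⇒∣-∣≤ (near-refl _))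
        telescope (suc T) s = begin
          ∣ (tokens (suc T) ▷ Pˢ) w - c ∣
            ≈⟨ ∣∣-cong split ⟩
          ∣ (routingError T ▷ Pˢ) w + ((tokens T ▷ matrixPower P (suc s)) w - c′) ∣
            ≤⟨ ∣x+y∣≤∣x∣+∣y∣ _ _ ⟩
          ∣ (routingError T ▷ Pˢ) w ∣ + ∣ (tokens T ▷ matrixPower P (suc s)) w - c′ ∣
            ≤⟨ +-mono-≤ (∣routingError▷∣≤ T s) (telescope T (suc s)) ⟩
          K * d s + K * sumFrom d (suc s) T
            ≈⟨ distribˡ K (d s) (sumFrom d (suc s) T) ⟨
          K * (d s + sumFrom d (suc s) T)
            ≈⟨ *-congˡ (sumFrom-suc d s T) ⟨
          K * sumFrom d s (suc T) ∎
          where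
          K = errorBound * r
          Pˢ = matrixPower P s
          c = (tokens 0 ▷ matrixPower P (suc T ℕ.+ s)) w
          c′ = (tokens 0 ▷ matrixPower P (T ℕ.+ suc s)) w
          split : (tokens (suc T) ▷ Pˢ) w - c ≈ (routingError T ▷ Pˢ) w + ((tokens T ▷ matrixPower P (suc s)) w - c′)
          split = begin-equality
            (tokens (suc T) ▷ Pˢ) w - c
              ≈⟨ sub-cong (sym (x-y+y≈x _ _)) (reflexive (≡.cong (λ k → (tokens 0 ▷ matrixPower P k) w) (≡.sym (ℕ.+-suc T s)))) ⟩
            -- The expected configuration after one step, pushed through P^s, is subtracted and
            -- added back.
            (tokens (suc T) ▷ Pˢ) w - ((tokens T ▷ P) ▷ Pˢ) w + ((tokens T ▷ P) ▷ Pˢ) w - c′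
              ≈⟨ +-assoc _ _ _ ⟩
            (tokens (suc T) ▷ Pˢ) w - ((tokens T ▷ P) ▷ Pˢ) w + (((tokens T ▷ P) ▷ Pˢ) w - c′)
              ≈⟨ +-cong (▷-sub (tokens (suc T)) (tokens T ▷ P) Pˢ w) (sub-cong (▷-power-suc P (tokens T) s w) refl) ⟨
            (routingError T ▷ Pˢ) w + ((tokens T ▷ matrixPower P (suc s)) w - c′) ∎

  -- Reversibility and the final estimate

  module _ {n : ℕ} (P : Matrix (suc n)) (π : Vector Carrier (suc n))
           (ergodic : IsErgodic P) (stationary : IsStationary P π) (reversible : IsReversible P π) where

    open IsErgodic ergodic

    private
      0<π : ∀ v → 0# < π v
      0<π = stationary-positive P π stochastic stationary irreducible

    reversible-symmetric : ∀ {u v} → 0# < P u v → 0# < P v u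
    reversible-symmetric {u} {v} 0<Puv = ≰⇒> λ Pvu≤0 → <⇒≱ (*-positive (0<π u) 0<Puv) (begin
      π u * P u v ≈⟨ reversible u v ⟩
      π v * P v u ≤⟨ *-monoˡ-≤ (proj₁ (0<π v)) Pvu≤0 ⟩
      π v * 0#    ≈⟨ zeroʳ _ ⟩
      0#          ∎)

    -- Reversibility turns column `w` of the deviation into row `w` with weights π_w / π_u, and π_u
    -- ≥ π_min.
    column-deviation : ∀ w s → sum (λ u → ∣ matrixPower P s u w - π w ∣) ≤
                               (π w ÷ minimum π) * distance P π stochastic stationary w s
    column-deviation w s = begin
      sum (λ u → ∣ matrixPower P s u w - π w ∣)
        ≤⟨ sum-mono {suc n} (λ u → *≤⇒≤÷* (minimum-positive π 0<π) (entry u)) ⟩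
      sum (λ u → (π w ÷ minimum π) * ∣ matrixPower P s w u - π u ∣)
        ≈⟨ *-distribˡ-sum {suc n} (π w ÷ minimum π) (λ u → ∣ matrixPower P s w u - π u ∣) ⟨
      (π w ÷ minimum π) * distance P π stochastic stationary w s ∎
      where
      entry : ∀ u → minimum π * ∣ matrixPower P s u w - π w ∣ ≤ π w * ∣ matrixPower P s w u - π u ∣
      entry u = begin
        minimum π * ∣ matrixPower P s u w - π w ∣
          ≤⟨ *-monoʳ-≤ (0≤∣x∣ (matrixPower P s u w - π w)) (minimum≤ π u) ⟩
        π u * ∣ matrixPower P s u w - π w ∣
          ≤⟨ *∣∣≤∣*∣ (proj₁ (0<π u)) (matrixPower P s u w - π w) ⟩
        ∣ π u * (matrixPower P s u w - π w) ∣
          ≈⟨ ∣∣-cong (trans (*-distribˡ-sub (π u) (matrixPower P s u w) (π w)) (trans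
               (sub-cong (reversible-power P π stochastic stationary reversible s u w) (*-comm (π u) (π w)))
               (sym (*-distribˡ-sub (π w) (matrixPower P s w u) (π u))))) ⟩
        ∣ π w * (matrixPower P s w u - π u) ∣
          ≤⟨ ∣x*y∣≤∣x∣*∣y∣ (π w) (matrixPower P s w u - π u) ⟩
        ∣ π w ∣ * ∣ matrixPower P s w u - π u ∣
          ≈⟨ *-congʳ (0≤x⇒∣x∣≈x (proj₁ (0<π w))) ⟩
        π w * ∣ matrixPower P s w u - π u ∣ ∎

    discrepancy-bound : ∀ t* → IsMixingRate P π t* → (router : QuasiRandomRouter P) (χ₀ : Vector ℕ (suc n)) → ∀ w T →
      ∣ fromℕ (χ router χ₀ T w) - μ P χ₀ T w ∣
        ≤ (fromℕ 6 * π w ÷ minimum π) * lg (suc (∑ℕ χ₀)) * fromℕ t* * fromℕ (maxDegree P)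
    discrepancy-bound t* mixing router χ₀ w T = begin
      ∣ fromℕ (χ router χ₀ T w) - μ P χ₀ T w ∣
        ≈⟨ ∣∣-cong (sub-cong (▷-power-zero P (x T) w)
             (reflexive (≡.cong (λ k → (x 0 ▷ matrixPower P k) w) (ℕ.+-identityʳ T)))) ⟨
      ∣ (x T ▷ matrixPower P 0) w - (x 0 ▷ matrixPower P (T ℕ.+ 0)) w ∣
        ≤⟨ telescope P stochastic router χ₀ reversible-symmetric π w r (distance P π stochastic stationary w) (column-deviation w) T 0 ⟩
      K * r * sumFrom (distance P π stochastic stationary w) 0 T
        ≤⟨ *-monoˡ-≤ 0≤Kr (sum-distance P π stochastic stationary mixing w T) ⟩
      K * r * (fromℕ 3 * fromℕ t*)
        -- The constant is 6 = 2 · 3: two thresholds for each edge, and distances that sum to at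
        -- most 3 t*.
        ≈⟨ solve 6 (λ i Δ L p m t → Δ :* (L :+ L) :* (p :* m) :* ((i :+ (i :+ (i :+ con 0))) :* t) :=
             (i :+ (i :+ (i :+ (i :+ (i :+ (i :+ con 0)))))) :* p :* m :* L :* t :* Δ) refl
             1# (fromℕ (maxDegree P)) (lg (suc (∑ℕ χ₀))) (π w) (minimum π ⁻¹) (fromℕ t*) ⟩
      (fromℕ 6 * π w ÷ minimum π) * lg (suc (∑ℕ χ₀)) * fromℕ t* * fromℕ (maxDegree P) ∎
      where
      x = tokens P stochastic router χ₀
      r = π w ÷ minimum π
      K = errorBound P stochastic router χ₀ reversible-symmetric
      0≤Kr : 0# ≤ K * r
      0≤Kr = *-nonNegative (errorBound-nonNegative P stochastic router χ₀ reversible-symmetric)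
        (*-nonNegative (proj₁ (0<π w)) (⁻¹-nonNegative (minimum-positive π 0<π)))

open import Defs

theorem5p7 : {{ℝ : CompleteOrderedField}} →
    ∀ {n : ℕ} (P : Matrix (suc n)) (π : Vector Carrier (suc n)) (t* : ℕ) →
    IsErgodic P → IsStationary P π → IsReversible P π → IsMixingRate P π t* →
    (router : QuasiRandomRouter P) (M : ℕ) (χ₀ : Vector ℕ (suc n)) → ∑ℕ χ₀ ≡ M →
    (w : Fin (suc n)) (T : ℕ) →
    ∣ fromℕ (χ router χ₀ T w) - μ P χ₀ T w ∣
    ≤ (fromℕ 6 * π w ÷ minimum π) * lg (suc M) * fromℕ t* * fromℕ (maxDegree P)
theorem5p7 P π t* ergodic stationary reversible mixing router _ χ₀ ≡.refl =
  discrepancy-bound P π ergodic stationary reversible t* mixing router χ₀
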